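{- For every integer $N \geq 1$ and all $x_1, \dots, x_N \in \mathbb{T}$, $$ N\sum_{\substack{k \geq 1 \\ k \text{ odd}}} \frac{8}{k^2}\left| \sum_{n=1}^{N} e^{2 \pi i k x_n}\right|^2 \leq \sum_{k=1}^{\infty} \frac{2}{k^2} \left| \sum_{n=1}^{N} e^{2 \pi i k x_n}\right|^4 + \pi^2 N^2 . $$
   Context: $\mathbb{T} = \mathbb{R}/\mathbb{Z}$ is the one-dimensional torus, identified with $[0,1]$ with endpoints glued. -}

module Defs where

open import Data.Fin.Base using (Fin)
open import Data.Integer.Base as ℤ using (ℤ)
import Data.Integer.Properties as ℤP
open import Data.Nat.Base as ℕ using (ℕ; zero; suc)
import Data.Nat.Properties as ℕP
open import Data.Product.Base using (∃; _×_; _,_; proj₁; proj₂)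
open import Data.Rational.Base as ℚ using (ℚ; mkℚ; 0ℚ; 1ℚ; ½)
import Data.Rational.Properties as ℚP
open import Data.Rational.Solver using (module +-*-Solver)
import Data.Rational.Unnormalised.Base as ℚᵘ
import Data.Rational.Unnormalised.Properties as ℚᵘP
open import Data.Sum.Base using (inj₁; inj₂; [_,_]′)
open import Data.Vec.Functional using (foldr)
open import Level using (0ℓ)
open import Relation.Binary.Bundles using (Setoid)
open import Relation.Binary.PropositionalEquality
  using (_≡_; refl; sym; trans; cong; cong₂; subst; subst₂)

open +-*-Solver using (solve; _:=_; _:+_; _:*_; _:-_; :-_; con)

ℤ→ℚ : ℤ → ℚ
ℤ→ℚ m = m ℚ./ 1

ℕ→ℚ : ℕ → ℚ
ℕ→ℚ n = ℤ→ℚ (ℤ.+ n)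

-- 1 / (n + 1)
recip : ℕ → ℚ
recip n = ℤ.+ 1 ℚ./ suc n

toℚᵘ-ℤ : ∀ m → ℚ.toℚᵘ (ℤ→ℚ m) ℚᵘ.≃ ℚᵘ.mkℚᵘ m 0
toℚᵘ-ℤ m = ℚP.toℚᵘ-fromℚᵘ (ℚᵘ.mkℚᵘ m 0)

toℚᵘ-recip : ∀ n → ℚ.toℚᵘ (recip n) ℚᵘ.≃ ℚᵘ.mkℚᵘ (ℤ.+ 1) n
toℚᵘ-recip n = ℚP.toℚᵘ-fromℚᵘ (ℚᵘ.mkℚᵘ (ℤ.+ 1) n)

ℤ→ℚ-+ : ∀ m n → ℤ→ℚ (m ℤ.+ n) ≡ ℤ→ℚ m ℚ.+ ℤ→ℚ n
ℤ→ℚ-+ m n = ℚP.toℚᵘ-injective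
  (ℚᵘP.≃-trans (toℚᵘ-ℤ (m ℤ.+ n))
  (ℚᵘP.≃-trans (ℚᵘ.*≡* (cong (ℤ._* ℤ.+ 1)
     (cong₂ ℤ._+_ (sym (ℤP.*-identityʳ m)) (sym (ℤP.*-identityʳ n)))))
  (ℚᵘP.≃-trans (ℚᵘP.+-cong (ℚᵘP.≃-sym (toℚᵘ-ℤ m)) (ℚᵘP.≃-sym (toℚᵘ-ℤ n)))
    (ℚᵘP.≃-sym (ℚP.toℚᵘ-homo-+ (ℤ→ℚ m) (ℤ→ℚ n))))))

ℤ→ℚ-neg : ∀ m → ℤ→ℚ (ℤ.- m) ≡ ℚ.- ℤ→ℚ m
ℤ→ℚ-neg m = trans
  (solve 2 (λ a b → b := (b :+ a) :- a) refl (ℤ→ℚ m) (ℤ→ℚ (ℤ.- m)))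
  (trans (cong (ℚ._- ℤ→ℚ m)
     (trans (sym (ℤ→ℚ-+ (ℤ.- m) m)) (cong ℤ→ℚ (ℤP.+-inverseˡ m))))
     (ℚP.+-identityˡ _))

recip-pos : ∀ n → 0ℚ ℚ.< recip n
recip-pos n = ℚP.positive⁻¹ (recip n) {{ℚP.normalize-pos 1 (suc n)}}

ℕ→ℚ-nonneg : ∀ n → 0ℚ ℚ.≤ ℕ→ℚ n
ℕ→ℚ-nonneg n = ℚP.nonNegative⁻¹ (ℕ→ℚ n) {{ℚP.normalize-nonNeg n 1}}

suc*recip : ∀ n → ℕ→ℚ (suc n) ℚ.* recip n ≡ 1ℚ
suc*recip n = ℚP.toℚᵘ-injective
  (ℚᵘP.≃-trans (ℚP.toℚᵘ-homo-* (ℕ→ℚ (suc n)) (recip n))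
  (ℚᵘP.≃-trans (ℚᵘP.*-cong (toℚᵘ-ℤ (ℤ.+ suc n)) (toℚᵘ-recip n))
    (ℚᵘ.*≡* (trans (ℤP.*-identityʳ _) (trans (ℤP.*-identityʳ (ℤ.+ suc n))
       (trans (cong ℤ.+_ (sym (ℕP.*-identityˡ (suc n))))
              (sym (ℤP.*-identityˡ _))))))))

ℕ→ℚ-mono : ∀ {m n} → m ℕ.≤ n → ℕ→ℚ m ℚ.≤ ℕ→ℚ n
ℕ→ℚ-mono {m} {n} m≤n = ℚP.toℚᵘ-cancel-≤
  (ℚᵘP.≤-trans (ℚᵘP.≤-reflexive (toℚᵘ-ℤ (ℤ.+ m)))
  (ℚᵘP.≤-trans (ℚᵘ.*≤* (ℤP.*-monoʳ-≤-nonNeg (ℤ.+ 1) (ℤ.+≤+ m≤n)))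
    (ℚᵘP.≤-reflexive (ℚᵘP.≃-sym (toℚᵘ-ℤ (ℤ.+ n))))))

∣q∣≤ℕ : ∀ q → ℚ.∣ q ∣ ℚ.≤ ℕ→ℚ (suc ℤ.∣ ℚ.↥ q ∣)
∣q∣≤ℕ (mkℚ a d c) = ℚP.toℚᵘ-cancel-≤
  (ℚᵘP.≤-trans
    (ℚᵘ.*≤* (subst₂ ℤ._≤_ (ℤP.pos-* ℤ.∣ a ∣ 1) (ℤP.pos-* (suc ℤ.∣ a ∣) (suc d))
       (ℤ.+≤+ (ℕP.*-mono-≤ (ℕP.n≤1+n ℤ.∣ a ∣) (ℕ.s≤s (ℕ.z≤n {d}))))))
    (ℚᵘP.≤-reflexive (ℚᵘP.≃-sym (toℚᵘ-ℤ (ℤ.+ suc ℤ.∣ a ∣)))))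

archimedean : ∀ ε → 0ℚ ℚ.< ε → ∃ λ N → ∀ n → N ℕ.≤ n → recip n ℚ.≤ ε
archimedean (mkℚ (ℤ.+ zero) d c) (ℚ.*<* (ℤ.+<+ ()))
archimedean (mkℚ ℤ.-[1+ _ ] d c) (ℚ.*<* ())
archimedean (mkℚ ℤ.+[1+ a ] d c) _ = d , λ n d≤n → ℚP.toℚᵘ-cancel-≤
  (ℚᵘP.≤-trans (ℚᵘP.≤-reflexive (toℚᵘ-recip n))
    (ℚᵘ.*≤* (subst₂ ℤ._≤_ (ℤP.pos-* 1 (suc d)) (ℤP.pos-* (suc a) (suc n))
       (ℤ.+≤+ (ℕP.*-mono-≤ (ℕ.s≤s (ℕ.z≤n {a})) (ℕ.s≤s d≤n))))))

half : ℚ → ℚ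
half ε = ε ℚ.* ½

half+half : ∀ ε → half ε ℚ.+ half ε ≡ ε
half+half = solve 1 (λ e → e :* con ½ :+ e :* con ½ := e) refl

*-pos : ∀ {p q} → 0ℚ ℚ.< p → 0ℚ ℚ.< q → 0ℚ ℚ.< p ℚ.* q
*-pos {p} {q} 0<p 0<q = ℚP.positive⁻¹ _
  {{ℚP.pos*pos⇒pos p {{ℚ.positive 0<p}} q {{ℚ.positive 0<q}}}}

half-pos : ∀ {ε} → 0ℚ ℚ.< ε → 0ℚ ℚ.< half ε
half-pos 0<ε = *-pos 0<ε (ℚP.positive⁻¹ ½)

*-mono-≤-nonneg : ∀ {p q r s} → 0ℚ ℚ.≤ q → 0ℚ ℚ.≤ r →
                  p ℚ.≤ q → r ℚ.≤ s → p ℚ.* r ℚ.≤ q ℚ.* s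
*-mono-≤-nonneg {p} {q} {r} {s} 0≤q 0≤r p≤q r≤s = ℚP.≤-trans
  (ℚP.*-monoʳ-≤-nonNeg r {{ℚ.nonNegative 0≤r}} p≤q)
  (ℚP.*-monoˡ-≤-nonNeg q {{ℚ.nonNegative 0≤q}} r≤s)

*-nonneg : ∀ {p q} → 0ℚ ℚ.≤ p → 0ℚ ℚ.≤ q → 0ℚ ℚ.≤ p ℚ.* q
*-nonneg {p} {q} 0≤p 0≤q = ℚP.nonNegative⁻¹ _
  {{ℚP.nonNeg*nonNeg⇒nonNeg p {{ℚ.nonNegative 0≤p}} q {{ℚ.nonNegative 0≤q}}}}

p≤p+q : ∀ {p q} → 0ℚ ℚ.≤ q → p ℚ.≤ p ℚ.+ q
p≤p+q {p} {q} 0≤q = subst (ℚ._≤ p ℚ.+ q) (ℚP.+-identityʳ p) (ℚP.+-monoʳ-≤ p 0≤q)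

∣p-q∣≡∣q-p∣ : ∀ p q → ℚ.∣ p ℚ.- q ∣ ≡ ℚ.∣ q ℚ.- p ∣
∣p-q∣≡∣q-p∣ p q = trans (sym (ℚP.∣-p∣≡∣p∣ (p ℚ.- q)))
  (cong ℚ.∣_∣ (solve 2 (λ a b → :- (a :- b) := b :- a) refl p q))

∣p-r∣≤ : ∀ p q r → ℚ.∣ p ℚ.- r ∣ ℚ.≤ ℚ.∣ p ℚ.- q ∣ ℚ.+ ℚ.∣ q ℚ.- r ∣
∣p-r∣≤ p q r = subst (λ t → ℚ.∣ t ∣ ℚ.≤ ℚ.∣ p ℚ.- q ∣ ℚ.+ ℚ.∣ q ℚ.- r ∣)
  (solve 3 (λ a b c → (a :- b) :+ (b :- c) := a :- c) refl p q r)
  (ℚP.∣p+q∣≤∣p∣+∣q∣ (p ℚ.- q) (q ℚ.- r))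

∣p∣≤∣p-q∣+∣q∣ : ∀ p q → ℚ.∣ p ∣ ℚ.≤ ℚ.∣ p ℚ.- q ∣ ℚ.+ ℚ.∣ q ∣
∣p∣≤∣p-q∣+∣q∣ p q = subst (λ t → ℚ.∣ t ∣ ℚ.≤ ℚ.∣ p ℚ.- q ∣ ℚ.+ ℚ.∣ q ∣)
  (solve 2 (λ a b → (a :- b) :+ b := a) refl p q)
  (ℚP.∣p+q∣≤∣p∣+∣q∣ (p ℚ.- q) q)

∣p∣-∣q∣≤∣p-q∣ : ∀ p q → ℚ.∣ p ∣ ℚ.- ℚ.∣ q ∣ ℚ.≤ ℚ.∣ p ℚ.- q ∣
∣p∣-∣q∣≤∣p-q∣ p q = subst (ℚ.∣ p ∣ ℚ.- ℚ.∣ q ∣ ℚ.≤_)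
  (solve 2 (λ a b → (a :+ b) :- b := a) refl ℚ.∣ p ℚ.- q ∣ ℚ.∣ q ∣)
  (ℚP.+-monoˡ-≤ (ℚ.- ℚ.∣ q ∣) (∣p∣≤∣p-q∣+∣q∣ p q))

∣∣p∣-∣q∣∣≤∣p-q∣ : ∀ p q → ℚ.∣ ℚ.∣ p ∣ ℚ.- ℚ.∣ q ∣ ∣ ℚ.≤ ℚ.∣ p ℚ.- q ∣
∣∣p∣-∣q∣∣≤∣p-q∣ p q with ℚP.∣p∣≡p∨∣p∣≡-p (ℚ.∣ p ∣ ℚ.- ℚ.∣ q ∣)
... | inj₁ eq = subst (ℚ._≤ ℚ.∣ p ℚ.- q ∣) (sym eq) (∣p∣-∣q∣≤∣p-q∣ p q)
... | inj₂ eq = subst₂ ℚ._≤_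
  (sym (trans eq (solve 2 (λ a b → :- (a :- b) := b :- a) refl ℚ.∣ p ∣ ℚ.∣ q ∣)))
  (∣p-q∣≡∣q-p∣ q p) (∣p∣-∣q∣≤∣p-q∣ q p)

-- Reals are Cauchy sequences of rationals; two sequences represent the same
-- real when they are related by _≈_ below.
Cauchyℚ : (ℕ → ℚ) → Set
Cauchyℚ s = ∀ ε → 0ℚ ℚ.< ε →
  ∃ λ N → ∀ m n → N ℕ.≤ m → N ℕ.≤ n → ℚ.∣ s m ℚ.- s n ∣ ℚ.≤ ε

record ℝ : Set where
  constructor mkℝ
  field
    seq    : ℕ → ℚ
    cauchy : Cauchyℚ seq

open ℝ public

infix 4 _≈_ _≤_ _<_

_≈_ : ℝ → ℝ → Set
x ≈ y = ∀ ε → 0ℚ ℚ.< ε →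
  ∃ λ N → ∀ n → N ℕ.≤ n → ℚ.∣ seq x n ℚ.- seq y n ∣ ℚ.≤ ε

-- Sequences are only constrained in the limit, hence the slack ε: pointwise
-- comparison would be too strong.
_≤_ : ℝ → ℝ → Set
x ≤ y = ∀ ε → 0ℚ ℚ.< ε → ∃ λ N → ∀ n → N ℕ.≤ n → seq x n ℚ.≤ seq y n ℚ.+ ε

_<_ : ℝ → ℝ → Set
x < y = ∃ λ ε → 0ℚ ℚ.< ε ×
  (∃ λ N → ∀ n → N ℕ.≤ n → seq x n ℚ.+ ε ℚ.≤ seq y n)

ι : ℚ → ℝ
ι q = mkℝ (λ _ → q) λ ε 0<ε → 0 , λ _ _ _ _ →
  subst (ℚ._≤ ε) (sym (cong ℚ.∣_∣ (ℚP.+-inverseʳ q))) (ℚP.<⇒≤ 0<ε)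

infixl 6 _+_ _-_
infixl 7 _*_
infix  8 -_

_+_ : ℝ → ℝ → ℝ
x + y = mkℝ (λ n → seq x n ℚ.+ seq y n) λ ε 0<ε →
  let (M , f) = cauchy x (half ε) (half-pos 0<ε)
      (N , g) = cauchy y (half ε) (half-pos 0<ε)
  in M ℕ.⊔ N , λ m n p q →
    subst₂ (λ s t → ℚ.∣ s ∣ ℚ.≤ t)
      (solve 4 (λ a b c d → (a :- b) :+ (c :- d) := (a :+ c) :- (b :+ d)) refl
        (seq x m) (seq x n) (seq y m) (seq y n))
      (half+half ε)
      (ℚP.≤-trans (ℚP.∣p+q∣≤∣p∣+∣q∣ (seq x m ℚ.- seq x n) (seq y m ℚ.- seq y n))
        (ℚP.+-mono-≤
          (f m n (ℕP.m⊔n≤o⇒m≤o M N p) (ℕP.m⊔n≤o⇒m≤o M N q))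
          (g m n (ℕP.m⊔n≤o⇒n≤o M N p) (ℕP.m⊔n≤o⇒n≤o M N q))))

-_ : ℝ → ℝ
- x = mkℝ (λ n → ℚ.- seq x n) λ ε 0<ε →
  let (N , f) = cauchy x ε 0<ε
  in N , λ m n p q →
    subst (λ t → ℚ.∣ t ∣ ℚ.≤ ε)
      (solve 2 (λ a b → b :- a := (:- a) :- (:- b)) refl (seq x m) (seq x n))
      (f n m q p)

_-_ : ℝ → ℝ → ℝ
x - y = x + (- y)

∣_∣ : ℝ → ℝ
∣ x ∣ = mkℝ (λ n → ℚ.∣ seq x n ∣) λ ε 0<ε →
  let (N , f) = cauchy x ε 0<ε
  in N , λ m n p q →
    ℚP.≤-trans (∣∣p∣-∣q∣∣≤∣p-q∣ (seq x m) (seq x n)) (f m n p q)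

eventually-bounded : ∀ x →
  ∃ λ B → ∃ λ N → ∀ n → N ℕ.≤ n → ℚ.∣ seq x n ∣ ℚ.≤ ℕ→ℚ (suc B)
eventually-bounded x =
  let (N , f) = cauchy x 1ℚ (ℚP.positive⁻¹ 1ℚ)
      b = 1ℚ ℚ.+ ℚ.∣ seq x N ∣
      0≤b = ℚP.+-mono-≤ (ℚP.nonNegative⁻¹ 1ℚ) (ℚP.0≤∣p∣ (seq x N))
  in ℤ.∣ ℚ.↥ b ∣ , N , λ n N≤n →
    ℚP.≤-trans (∣p∣≤∣p-q∣+∣q∣ (seq x n) (seq x N))
    (ℚP.≤-trans (ℚP.+-monoˡ-≤ ℚ.∣ seq x N ∣ (f n N N≤n ℕP.≤-refl))
    (subst (ℚ._≤ ℕ→ℚ (suc ℤ.∣ ℚ.↥ b ∣)) (ℚP.0≤p⇒∣p∣≡p 0≤b) (∣q∣≤ℕ b)))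

scale-cancel : ∀ B ε → ℕ→ℚ (suc B) ℚ.* (ε ℚ.* recip B) ≡ ε
scale-cancel B ε = trans
  (solve 3 (λ b e r → b :* (e :* r) := (b :* r) :* e) refl (ℕ→ℚ (suc B)) ε (recip B))
  (trans (cong (ℚ._* ε) (suc*recip B)) (ℚP.*-identityˡ ε))

_*_ : ℝ → ℝ → ℝ
x * y = mkℝ (λ n → seq x n ℚ.* seq y n) λ ε 0<ε →
  let (A , I , a) = eventually-bounded x
      (B , J , b) = eventually-bounded y
      0<h = half-pos 0<ε
      (M , f) = cauchy x (half ε ℚ.* recip B) (*-pos 0<h (recip-pos B))
      (N , g) = cauchy y (half ε ℚ.* recip A) (*-pos 0<h (recip-pos A))
  in (I ℕ.⊔ J) ℕ.⊔ (M ℕ.⊔ N) , λ m n p q →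
    let p₁ = ℕP.m⊔n≤o⇒m≤o (I ℕ.⊔ J) (M ℕ.⊔ N) p
        q₁ = ℕP.m⊔n≤o⇒m≤o (I ℕ.⊔ J) (M ℕ.⊔ N) q
        p₂ = ℕP.m⊔n≤o⇒n≤o (I ℕ.⊔ J) (M ℕ.⊔ N) p
        q₂ = ℕP.m⊔n≤o⇒n≤o (I ℕ.⊔ J) (M ℕ.⊔ N) q
        u = seq x m ℚ.* (seq y m ℚ.- seq y n)
        v = seq y n ℚ.* (seq x m ℚ.- seq x n)
        ∣u∣≤ = subst₂ ℚ._≤_ (sym (ℚP.∣p*q∣≡∣p∣*∣q∣ (seq x m) (seq y m ℚ.- seq y n)))
                 (scale-cancel A (half ε))
                 (*-mono-≤-nonneg (ℕ→ℚ-nonneg (suc A)) (ℚP.0≤∣p∣ _)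
                   (a m (ℕP.m⊔n≤o⇒m≤o I J p₁))
                   (g m n (ℕP.m⊔n≤o⇒n≤o M N p₂) (ℕP.m⊔n≤o⇒n≤o M N q₂)))
        ∣v∣≤ = subst₂ ℚ._≤_ (sym (ℚP.∣p*q∣≡∣p∣*∣q∣ (seq y n) (seq x m ℚ.- seq x n)))
                 (scale-cancel B (half ε))
                 (*-mono-≤-nonneg (ℕ→ℚ-nonneg (suc B)) (ℚP.0≤∣p∣ _)
                   (b n (ℕP.m⊔n≤o⇒n≤o I J q₁))
                   (f m n (ℕP.m⊔n≤o⇒m≤o M N p₂) (ℕP.m⊔n≤o⇒m≤o M N q₂)))
    in subst₂ (λ s t → ℚ.∣ s ∣ ℚ.≤ t)
         (solve 4 (λ a b c d → a :* (c :- d) :+ d :* (a :- b) := a :* c :- b :* d)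
           refl (seq x m) (seq x n) (seq y m) (seq y n))
         (half+half ε)
         (ℚP.≤-trans (ℚP.∣p+q∣≤∣p∣+∣q∣ u v) (ℚP.+-mono-≤ ∣u∣≤ ∣v∣≤))

_⟶_ : (ℕ → ℝ) → ℝ → Set
f ⟶ L = ∀ ε → 0ℚ ℚ.< ε → ∃ λ N → ∀ n → N ℕ.≤ n → ∣ f n - L ∣ ≤ ι ε

Cauchy : (ℕ → ℝ) → Set
Cauchy f = ∀ ε → 0ℚ ℚ.< ε →
  ∃ λ N → ∀ m n → N ℕ.≤ m → N ℕ.≤ n → ∣ f m - f n ∣ ≤ ι ε

module _ (f : ℕ → ℝ) where

  modulus : ℕ → ℕ
  modulus n = proj₁ (cauchy (f n) (recip n) (recip-pos n))

  -- A rational within 1/(n+1) of f n.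
  approx : ℕ → ℚ
  approx n = seq (f n) (modulus n)

  approx-close : ∀ n k → modulus n ℕ.≤ k → ℚ.∣ approx n ℚ.- seq (f n) k ∣ ℚ.≤ recip n
  approx-close n k p =
    proj₂ (cauchy (f n) (recip n) (recip-pos n)) (modulus n) k ℕP.≤-refl p

  module _ (c : Cauchy f) where

    approx-f : ∀ ε → 0ℚ ℚ.< ε → ∃ λ N → ∀ m n → N ℕ.≤ m → N ℕ.≤ n →
      ∃ λ K → ∀ k → K ℕ.≤ k → ℚ.∣ seq (f m) k ℚ.- approx n ∣ ℚ.≤ ε
    approx-f ε 0<ε =
      let e = half (half ε)
          0<e = half-pos (half-pos 0<ε)
          (A , a) = archimedean (half ε) (half-pos 0<ε)
          (M , h) = c e 0<e
      in A ℕ.⊔ M , λ m n p q →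
        let (K , g) = h m n (ℕP.m⊔n≤o⇒n≤o A M p) (ℕP.m⊔n≤o⇒n≤o A M q) e 0<e
        in K ℕ.⊔ modulus n , λ k r →
          subst (ℚ.∣ seq (f m) k ℚ.- approx n ∣ ℚ.≤_) (half+half ε)
          (ℚP.≤-trans (∣p-r∣≤ (seq (f m) k) (seq (f n) k) (approx n))
            (ℚP.+-mono-≤
              (subst (ℚ.∣ seq (f m) k ℚ.- seq (f n) k ∣ ℚ.≤_) (half+half (half ε))
                (g k (ℕP.m⊔n≤o⇒m≤o K (modulus n) r)))
              (ℚP.≤-trans (subst (ℚ._≤ recip n) (∣p-q∣≡∣q-p∣ (approx n) (seq (f n) k))
                  (approx-close n k (ℕP.m⊔n≤o⇒n≤o K (modulus n) r)))
                (a n (ℕP.m⊔n≤o⇒m≤o A M q)))))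

    approx-cauchy : Cauchyℚ approx
    approx-cauchy ε 0<ε =
      let (A , a) = archimedean (half ε) (half-pos 0<ε)
          (M , h) = approx-f (half ε) (half-pos 0<ε)
      in A ℕ.⊔ M , λ m n p q →
        let (K , g) = h m n (ℕP.m⊔n≤o⇒n≤o A M p) (ℕP.m⊔n≤o⇒n≤o A M q)
            k = K ℕ.⊔ modulus m
        in subst (ℚ.∣ approx m ℚ.- approx n ∣ ℚ.≤_) (half+half ε)
          (ℚP.≤-trans (∣p-r∣≤ (approx m) (seq (f m) k) (approx n))
            (ℚP.+-mono-≤
              (ℚP.≤-trans (approx-close m k (ℕP.m≤n⊔m K (modulus m)))
                          (a m (ℕP.m⊔n≤o⇒m≤o A M p)))
              (g k (ℕP.m≤m⊔n K (modulus m)))))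

    lim : ℝ
    lim = mkℝ approx approx-cauchy

    lim-⟶ : f ⟶ lim
    lim-⟶ ε 0<ε =
      let (N , h) = approx-f ε 0<ε
      in N , λ n p δ 0<δ →
        let (K , g) = cauchy (f n) δ 0<δ
        in N ℕ.⊔ K , λ k r →
          let (K′ , g′) = h n k p (ℕP.m⊔n≤o⇒m≤o N K r)
              k′ = K ℕ.⊔ K′
          in subst (ℚ.∣ seq (f n) k ℚ.- approx k ∣ ℚ.≤_) (ℚP.+-comm δ ε)
            (ℚP.≤-trans (∣p-r∣≤ (seq (f n) k) (seq (f n) k′) (approx k))
              (ℚP.+-mono-≤
                (g k k′ (ℕP.m⊔n≤o⇒n≤o N K r) (ℕP.m≤m⊔n K K′))
                (g′ k′ (ℕP.m≤n⊔m K K′))))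

∑ : ℕ → (ℕ → ℝ) → ℝ
∑ zero    f = ι 0ℚ
∑ (suc n) f = ∑ n f + f n

-- The series f 0 + f 1 + ⋯ converges with sum s.
HasSum : (ℕ → ℝ) → ℝ → Set
HasSum f s = (λ n → ∑ n f) ⟶ s

infixl 6 _+ᶜ_
infixl 7 _*ᶜ_

record ℂ : Set where
  constructor mkℂ
  field
    re im : ℝ

open ℂ public

0ᶜ 1ᶜ : ℂ
0ᶜ = mkℂ (ι 0ℚ) (ι 0ℚ)
1ᶜ = mkℂ (ι 1ℚ) (ι 0ℚ)

_+ᶜ_ : ℂ → ℂ → ℂ
z +ᶜ w = mkℂ (re z + re w) (im z + im w)

_*ᶜ_ : ℂ → ℂ → ℂ
z *ᶜ w = mkℂ (re z * re w - im z * im w) (re z * im w + im z * re w)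

-- The square of the modulus; this avoids a square root on ℝ.
∣_∣² : ℂ → ℝ
∣ z ∣² = re z * re z + im z * im z

-- expTerm z j = z ^ j / j !; note that recip j is 1 / (j + 1).
expTerm : ℂ → ℕ → ℂ
expTerm z zero    = 1ᶜ
expTerm z (suc j) = mkℂ (ι (recip j)) (ι 0ℚ) *ᶜ (z *ᶜ expTerm z j)

expSum : ℂ → ℕ → ℂ
expSum z zero    = 0ᶜ
expSum z (suc n) = expSum z n +ᶜ expTerm z n

-- The numbers (2A) ^ j / j !, which dominate both components of expTerm z j
-- when the components of z are at most A in absolute value.
module _ (A : ℕ) where

  private
    C = ℕ→ℚ (A ℕ.+ A)
    J = (A ℕ.+ A) ℕ.+ (A ℕ.+ A)

  majorant : ℕ → ℚ
  majorant zero    = 1ℚ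
  majorant (suc j) = recip j ℚ.* (C ℚ.* majorant j)

  majorant-nonneg : ∀ j → 0ℚ ℚ.≤ majorant j
  majorant-nonneg zero    = ℚP.nonNegative⁻¹ 1ℚ
  majorant-nonneg (suc j) = *-nonneg (ℚP.<⇒≤ (recip-pos j))
    (*-nonneg (ℕ→ℚ-nonneg (A ℕ.+ A)) (majorant-nonneg j))

  majorant-halves : ∀ j → J ℕ.≤ suc j →
    majorant (suc j) ℚ.+ majorant (suc j) ℚ.≤ majorant j
  majorant-halves j J≤ = subst₂ ℚ._≤_
    (solve 3 (λ r c u → (c :+ c) :* (r :* u) := r :* (c :* u) :+ r :* (c :* u)) refl
      (recip j) C (majorant j))
    (trans (sym (ℚP.*-assoc (ℕ→ℚ (suc j)) (recip j) (majorant j)))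
      (trans (cong (ℚ._* majorant j) (suc*recip j)) (ℚP.*-identityˡ (majorant j))))
    (ℚP.*-monoʳ-≤-nonNeg (recip j ℚ.* majorant j)
      {{ℚ.nonNegative (*-nonneg (ℚP.<⇒≤ (recip-pos j)) (majorant-nonneg j))}}
      (subst (ℚ._≤ ℕ→ℚ (suc j)) (ℤ→ℚ-+ (ℤ.+ (A ℕ.+ A)) (ℤ.+ (A ℕ.+ A)))
        (ℕ→ℚ-mono J≤)))

  tail : ℕ → ℕ → ℚ
  tail n zero    = 0ℚ
  tail n (suc d) = tail n d ℚ.+ majorant (d ℕ.+ n)

  tail+≤ : ∀ n d → J ℕ.≤ n →
    tail n d ℚ.+ (majorant (d ℕ.+ n) ℚ.+ majorant (d ℕ.+ n)) ℚ.≤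
    majorant n ℚ.+ majorant n
  tail+≤ n zero    J≤n = ℚP.≤-reflexive (ℚP.+-identityˡ _)
  tail+≤ n (suc d) J≤n = ℚP.≤-trans
    (ℚP.+-monoʳ-≤ (tail n (suc d))
      (majorant-halves (d ℕ.+ n) (ℕP.≤-trans J≤n (ℕP.m≤n+m n (suc d)))))
    (subst (ℚ._≤ majorant n ℚ.+ majorant n)
      (sym (ℚP.+-assoc (tail n d) (majorant (d ℕ.+ n)) (majorant (d ℕ.+ n))))
      (tail+≤ n d J≤n))

  tail≤ : ∀ n d → J ℕ.≤ n → tail n d ℚ.≤ majorant n ℚ.+ majorant n
  tail≤ n d J≤n = ℚP.≤-trans
    (p≤p+q (ℚP.+-mono-≤ (majorant-nonneg (d ℕ.+ n)) (majorant-nonneg (d ℕ.+ n))))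
    (tail+≤ n d J≤n)

  majorant-decay : ∀ i → ℕ→ℚ (suc i) ℚ.* majorant (i ℕ.+ J) ℚ.≤ majorant J
  majorant-decay zero    = ℚP.≤-reflexive (ℚP.*-identityˡ (majorant J))
  majorant-decay (suc i) = ℚP.≤-trans
    (ℚP.*-monoʳ-≤-nonNeg u′ {{ℚ.nonNegative (majorant-nonneg (suc i ℕ.+ J))}}
      (ℕ→ℚ-mono (ℕP.≤-trans (ℕP.≤-reflexive (sym (ℕP.+-comm (suc i) 1)))
                            (ℕP.+-monoʳ-≤ (suc i) (ℕ.s≤s (ℕ.z≤n {i}))))))
    (ℚP.≤-trans
      (subst (ℚ._≤ ℕ→ℚ (suc i) ℚ.* u)
        (trans (solve 2 (λ a b → a :* (b :+ b) := (a :+ a) :* b) refl (ℕ→ℚ (suc i)) u′)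
               (cong (ℚ._* u′) (sym (ℤ→ℚ-+ (ℤ.+ suc i) (ℤ.+ suc i)))))
        (ℚP.*-monoˡ-≤-nonNeg (ℕ→ℚ (suc i)) {{ℚ.nonNegative (ℕ→ℚ-nonneg (suc i))}}
          (majorant-halves (i ℕ.+ J) (ℕP.≤-trans (ℕP.m≤n+m J i) (ℕP.n≤1+n _)))))
      (majorant-decay i))
    where
      u = majorant (i ℕ.+ J)
      u′ = majorant (suc i ℕ.+ J)

  tail-small : ∀ ε → 0ℚ ℚ.< ε → ∃ λ N → ∀ n d → N ℕ.≤ n → tail n d ℚ.≤ ε
  tail-small ε 0<ε =
    let K = ℤ.∣ ℚ.↥ (majorant J) ∣
        η = half ε ℚ.* recip K
        (I , h) = archimedean η (*-pos (half-pos 0<ε) (recip-pos K))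
    in I ℕ.+ J , λ n d I+J≤n →
      let J≤n = ℕP.≤-trans (ℕP.m≤n+m J I) I+J≤n
          i = n ℕ.∸ J
          I≤i = subst (ℕ._≤ i) (ℕP.m+n∸n≡m I J) (ℕP.∸-monoˡ-≤ J I+J≤n)
          u = majorant (i ℕ.+ J)
          u≤ = subst₂ ℚ._≤_
            (trans (solve 3 (λ r a b → r :* (a :* b) := (a :* r) :* b) refl
                     (recip i) (ℕ→ℚ (suc i)) u)
              (trans (cong (ℚ._* u) (suc*recip i)) (ℚP.*-identityˡ u)))
            (trans (ℚP.*-comm η (ℕ→ℚ (suc K))) (scale-cancel K (half ε)))
            (*-mono-≤-nonneg
              (ℚP.<⇒≤ (*-pos (half-pos 0<ε) (recip-pos K)))
              (*-nonneg (ℕ→ℚ-nonneg (suc i)) (majorant-nonneg (i ℕ.+ J)))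
              (h i I≤i)
              (ℚP.≤-trans (majorant-decay i)
                (subst (ℚ._≤ ℕ→ℚ (suc K)) (ℚP.0≤p⇒∣p∣≡p (majorant-nonneg J))
                  (∣q∣≤ℕ (majorant J)))))
          w≤ = subst (λ j → majorant j ℚ.≤ half ε) (ℕP.m∸n+n≡m J≤n) u≤
      in ℚP.≤-trans (tail≤ n d J≤n)
           (subst (majorant n ℚ.+ majorant n ℚ.≤_) (half+half ε) (ℚP.+-mono-≤ w≤ w≤))

  module _ (z : ℂ) (k : ℕ)
    (a≤ : ℚ.∣ seq (re z) k ∣ ℚ.≤ ℕ→ℚ A) (b≤ : ℚ.∣ seq (im z) k ∣ ℚ.≤ ℕ→ℚ A) where

    private
      combine : ∀ {a b c d u} → ℚ.∣ a ∣ ℚ.≤ ℕ→ℚ A → ℚ.∣ b ∣ ℚ.≤ ℕ→ℚ A →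
        ℚ.∣ c ∣ ℚ.≤ u → ℚ.∣ d ∣ ℚ.≤ u → ℚ.∣ a ℚ.* c ℚ.+ b ℚ.* d ∣ ℚ.≤ C ℚ.* u
      combine {a} {b} {c} {d} {u} ha hb hc hd = ℚP.≤-trans
        (ℚP.∣p+q∣≤∣p∣+∣q∣ (a ℚ.* c) (b ℚ.* d))
        (subst₂ ℚ._≤_
          (cong₂ ℚ._+_ (sym (ℚP.∣p*q∣≡∣p∣*∣q∣ a c)) (sym (ℚP.∣p*q∣≡∣p∣*∣q∣ b d)))
          (trans (sym (ℚP.*-distribʳ-+ u (ℕ→ℚ A) (ℕ→ℚ A)))
            (cong (ℚ._* u) (sym (ℤ→ℚ-+ (ℤ.+ A) (ℤ.+ A)))))
          (ℚP.+-mono-≤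
            (*-mono-≤-nonneg (ℕ→ℚ-nonneg A) (ℚP.0≤∣p∣ c) ha hc)
            (*-mono-≤-nonneg (ℕ→ℚ-nonneg A) (ℚP.0≤∣p∣ d) hb hd)))

      scale : ∀ j {p v} → ℚ.∣ p ∣ ℚ.≤ v → ℚ.∣ recip j ℚ.* p ∣ ℚ.≤ recip j ℚ.* v
      scale j {p} {v} hp = subst (ℚ._≤ recip j ℚ.* v)
        (trans (cong (ℚ._* ℚ.∣ p ∣) (sym (ℚP.0≤p⇒∣p∣≡p (ℚP.<⇒≤ (recip-pos j)))))
               (sym (ℚP.∣p*q∣≡∣p∣*∣q∣ (recip j) p)))
        (ℚP.*-monoˡ-≤-nonNeg (recip j) {{ℚ.nonNegative (ℚP.<⇒≤ (recip-pos j))}} hp)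

    expTerm-bound : ∀ j →
      ℚ.∣ seq (re (expTerm z j)) k ∣ ℚ.≤ majorant j ×
      ℚ.∣ seq (im (expTerm z j)) k ∣ ℚ.≤ majorant j
    expTerm-bound zero    = ℚP.≤-refl , ℚP.nonNegative⁻¹ 1ℚ
    expTerm-bound (suc j) =
      let (hc , hd) = expTerm-bound j
          a = seq (re z) k
          b = seq (im z) k
          c = seq (re (expTerm z j)) k
          d = seq (im (expTerm z j)) k
          r = recip j
      in subst (λ t → ℚ.∣ t ∣ ℚ.≤ majorant (suc j))
           (solve 5 (λ r a b c d → r :* (a :* c :+ b :* (:- d))
               := r :* (a :* c :- b :* d) :- con 0ℚ :* (a :* d :+ b :* c))
             refl r a b c d)
           (scale j (combine {a} {b} {c} {ℚ.- d} a≤ b≤ hc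
             (subst (ℚ._≤ majorant j) (sym (ℚP.∣-p∣≡∣p∣ d)) hd)))
       , subst (λ t → ℚ.∣ t ∣ ℚ.≤ majorant (suc j))
           (solve 5 (λ r a b c d → r :* (a :* d :+ b :* c)
               := r :* (a :* d :+ b :* c) :+ con 0ℚ :* (a :* c :- b :* d))
             refl r a b c d)
           (scale j (combine {a} {b} {d} {c} a≤ b≤ hd hc))

    module _ (part : ℂ → ℝ)
      (part-+ : ∀ w v → seq (part (w +ᶜ v)) k ≡ seq (part w) k ℚ.+ seq (part v) k)
      (part-bound : ∀ j → ℚ.∣ seq (part (expTerm z j)) k ∣ ℚ.≤ majorant j) where

      expSum-diff : ∀ n d →
        ℚ.∣ seq (part (expSum z (d ℕ.+ n))) k ℚ.- seq (part (expSum z n)) k ∣ ℚ.≤ tail n d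
      expSum-diff n zero    = ℚP.≤-reflexive
        (cong ℚ.∣_∣ (ℚP.+-inverseʳ (seq (part (expSum z n)) k)))
      expSum-diff n (suc d) =
        let s = seq (part (expSum z (d ℕ.+ n))) k
            t = seq (part (expTerm z (d ℕ.+ n))) k
            s₀ = seq (part (expSum z n)) k
        in subst (λ q → ℚ.∣ q ∣ ℚ.≤ tail n (suc d))
             (trans (solve 3 (λ s t s₀ → (s :- s₀) :+ t := (s :+ t) :- s₀) refl s t s₀)
               (cong (ℚ._- s₀) (sym (part-+ (expSum z (d ℕ.+ n)) (expTerm z (d ℕ.+ n))))))
             (ℚP.≤-trans (ℚP.∣p+q∣≤∣p∣+∣q∣ (s ℚ.- s₀) t)
               (ℚP.+-mono-≤ (expSum-diff n d) (part-bound (d ℕ.+ n))))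

expSum-cauchy : ∀ z →
  Cauchy (λ n → re (expSum z n)) × Cauchy (λ n → im (expSum z n))
expSum-cauchy z =
    go re (λ _ _ _ → refl) (λ k a b j → proj₁ (expTerm-bound A z k a b j))
  , go im (λ _ _ _ → refl) (λ k a b j → proj₂ (expTerm-bound A z k a b j))
  where
    A₁ = proj₁ (eventually-bounded (re z))
    A₂ = proj₁ (eventually-bounded (im z))
    K₁ = proj₁ (proj₂ (eventually-bounded (re z)))
    K₂ = proj₁ (proj₂ (eventually-bounded (im z)))
    A = suc A₁ ℕ.+ suc A₂

    bound₁ : ∀ k → K₁ ℕ.⊔ K₂ ℕ.≤ k → ℚ.∣ seq (re z) k ∣ ℚ.≤ ℕ→ℚ A
    bound₁ k p = ℚP.≤-trans
      (proj₂ (proj₂ (eventually-bounded (re z))) k (ℕP.m⊔n≤o⇒m≤o K₁ K₂ p))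
      (ℕ→ℚ-mono (ℕP.m≤m+n (suc A₁) (suc A₂)))

    bound₂ : ∀ k → K₁ ℕ.⊔ K₂ ℕ.≤ k → ℚ.∣ seq (im z) k ∣ ℚ.≤ ℕ→ℚ A
    bound₂ k p = ℚP.≤-trans
      (proj₂ (proj₂ (eventually-bounded (im z))) k (ℕP.m⊔n≤o⇒n≤o K₁ K₂ p))
      (ℕ→ℚ-mono (ℕP.m≤n+m (suc A₂) (suc A₁)))

    go : (part : ℂ → ℝ) →
      (∀ k w v → seq (part (w +ᶜ v)) k ≡ seq (part w) k ℚ.+ seq (part v) k) →
      (∀ k → ℚ.∣ seq (re z) k ∣ ℚ.≤ ℕ→ℚ A → ℚ.∣ seq (im z) k ∣ ℚ.≤ ℕ→ℚ A →
        ∀ j → ℚ.∣ seq (part (expTerm z j)) k ∣ ℚ.≤ majorant A j) →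
      Cauchy (λ n → part (expSum z n))
    go part part-+ part-bound ε 0<ε =
      let (N , small) = tail-small A ε 0<ε
          S : ℕ → ℕ → ℚ
          S n k = seq (part (expSum z n)) k
          ordered : ∀ m n k → N ℕ.≤ n → n ℕ.≤ m → K₁ ℕ.⊔ K₂ ℕ.≤ k →
            ℚ.∣ S m k ℚ.- S n k ∣ ℚ.≤ ε
          ordered m n k N≤n n≤m p = ℚP.≤-trans
            (subst (λ i → ℚ.∣ S i k ℚ.- S n k ∣ ℚ.≤ tail A n (m ℕ.∸ n))
              (ℕP.m∸n+n≡m n≤m)
              (expSum-diff A z k (bound₁ k p) (bound₂ k p) part (part-+ k)
                (part-bound k (bound₁ k p) (bound₂ k p)) n (m ℕ.∸ n)))
            (small n (m ℕ.∸ n) N≤n)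
          both : ∀ m n k → N ℕ.≤ m → N ℕ.≤ n → K₁ ℕ.⊔ K₂ ℕ.≤ k →
            ℚ.∣ S m k ℚ.- S n k ∣ ℚ.≤ ε
          both m n k p q r = [
              (λ m≤n → subst (ℚ._≤ ε) (∣p-q∣≡∣q-p∣ (S n k) (S m k))
                         (ordered n m k p m≤n r))
            , (λ n≤m → ordered m n k q n≤m r) ]′ (ℕP.≤-total m n)
      in N , λ m n p q δ 0<δ → K₁ ℕ.⊔ K₂ , λ k r →
           ℚP.≤-trans (both m n k p q r) (p≤p+q (ℚP.<⇒≤ 0<δ))

exp : ℂ → ℂ
exp z = mkℂ (lim (λ n → re (expSum z n)) (proj₁ (expSum-cauchy z)))
            (lim (λ n → im (expSum z n)) (proj₂ (expSum-cauchy z)))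

sin : ℝ → ℝ
sin x = im (exp (mkℂ (ι 0ℚ) x))

-- π is the least positive zero of sin.
IsPi : ℝ → Set
IsPi π = ι 0ℚ < π × sin π ≈ ι 0ℚ × (∀ x → ι 0ℚ < x → sin x ≈ ι 0ℚ → π ≤ x)

-- ℝ / ℤ; the elements are real representatives, equal when their difference
-- is an integer.
𝕋 : Setoid 0ℓ 0ℓ
𝕋 = record
  { Carrier = ℝ
  ; _≈_ = λ x y → ∃ λ m → x - y ≈ ι (ℤ→ℚ m)
  ; isEquivalence = record
    { refl  = λ {x} → ℤ.+ 0 , λ ε 0<ε → 0 , λ n _ →
        subst (λ t → ℚ.∣ t ∣ ℚ.≤ ε)
          (solve 1 (λ a → con 0ℚ := (a :- a) :- con 0ℚ) refl (seq x n))
          (ℚP.<⇒≤ 0<ε)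
    ; sym   = λ {x} {y} (m , h) → ℤ.- m , λ ε 0<ε →
        let (N , g) = h ε 0<ε
        in N , λ n p → subst (ℚ._≤ ε)
          (trans (sym (ℚP.∣-p∣≡∣p∣ _))
            (cong ℚ.∣_∣ (trans
              (solve 3 (λ a b c → :- ((a :- b) :- c) := (b :- a) :- (:- c)) refl
                (seq x n) (seq y n) (ℤ→ℚ m))
              (cong (λ t → (seq y n ℚ.- seq x n) ℚ.- t) (sym (ℤ→ℚ-neg m))))))
          (g n p)
    ; trans = λ {x} {y} {z} (l , h) (m , h′) → l ℤ.+ m , λ ε 0<ε →
        let (M , g) = h (half ε) (half-pos 0<ε)
            (N , g′) = h′ (half ε) (half-pos 0<ε)
        in M ℕ.⊔ N , λ n p → subst₂ (λ s t → ℚ.∣ s ∣ ℚ.≤ t)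
          (trans
            (solve 5 (λ a b c d e →
                ((a :- b) :- d) :+ ((b :- c) :- e) := (a :- c) :- (d :+ e)) refl
              (seq x n) (seq y n) (seq z n) (ℤ→ℚ l) (ℤ→ℚ m))
            (cong (λ t → (seq x n ℚ.- seq z n) ℚ.- t) (sym (ℤ→ℚ-+ l m))))
          (half+half ε)
          (ℚP.≤-trans
            (ℚP.∣p+q∣≤∣p∣+∣q∣ ((seq x n ℚ.- seq y n) ℚ.- ℤ→ℚ l)
                              ((seq y n ℚ.- seq z n) ℚ.- ℤ→ℚ m))
            (ℚP.+-mono-≤ (g n (ℕP.m⊔n≤o⇒m≤o M N p)) (g′ n (ℕP.m⊔n≤o⇒n≤o M N p))))
    }
  }

e^2πi : (π : ℝ) → ℕ → Setoid.Carrier 𝕋 → ℂ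
e^2πi π k x = exp (mkℂ (ι 0ℚ) (ι (ℕ→ℚ 2) * π * ι (ℕ→ℚ k) * x))

-- ∑ₙ e^{2πikxₙ}
trigSum : (π : ℝ) {N : ℕ} → (Fin N → Setoid.Carrier 𝕋) → ℕ → ℂ
trigSum π x k = foldr _+ᶜ_ 0ᶜ (λ n → e^2πi π k (x n))

{-# OPTIONS --safe #-}

-- Write Sₖ for the trigonometric sum of frequency k.  Since
-- 2 (|Sₖ|² - 2N)² ≥ 0, we have 8N |Sₖ|² ≤ 2 |Sₖ|⁴ + 8N² for each k; dividing
-- by k² and summing over odd k reduces the claim to ∑ 8 / k² ≤ π² over odd k.
--
-- The latter follows from 4 / sin² x = 1 / sin² (x/2) + 1 / sin² (π/2 - x/2).
-- Starting at x = π/4 and iterating e times, 2 becomes the sum of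
-- 4⁻ᵉ / sin² ((2k+1) π / 2ᵉ⁺²) over k < 2ᵉ, and sin² x ≤ x² bounds it below by
-- the sum of 16 / (π² (2k+1)²).  No division by a sine is needed: an inverse C
-- of sin x yields the inverses 2 cos (x/2) C and ± 2 sin (x/2) C of
-- sin (x/2) and sin (π/2 - x/2).
--
-- Real identities are obtained as linear combinations of null sequences of
-- rationals, whose expansion is checked by the ring solver on ℚ.

module Submission where

open import Defs
open import Data.Fin.Base as Fin using (Fin)
open import Data.Integer.Base as ℤ using (+_)
import Data.Integer.Properties as ℤP
open import Data.Nat.Base as ℕ using (ℕ; suc; zero)
import Data.Nat.Properties as ℕP
import Data.Nat.Solver
open import Data.Product.Base using (∃; _×_; _,_; proj₁; proj₂)
open import Data.Rational.Base as ℚ using (ℚ; 0ℚ; 1ℚ; ½)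
import Data.Rational.Properties as ℚP
open import Data.Rational.Solver using (module +-*-Solver)
import Data.Rational.Unnormalised.Base as ℚᵘ
import Data.Rational.Unnormalised.Properties as ℚᵘP
open import Data.Sum.Base using (inj₁; inj₂; [_,_]′)
open import Data.Vec.Functional using (foldr)
open import Function.Base using (_∘_)
open import Relation.Binary.Bundles using (Setoid)
open import Relation.Binary.PropositionalEquality
  using (_≡_; refl; sym; trans; cong; cong₂; subst; subst₂; module ≡-Reasoning)
open import Relation.Nullary using (¬_; yes; no; contradiction)

open +-*-Solver using (solve; _:=_; _:+_; _:*_; _:-_; :-_; con)

-- The minimality of π enters the tree of angles through cos (π/2) = 0, whence sin² (π/2) = 1. The
-- sign of sin (π/2) stays open, so this factor is carried along symbolically until it is squared.
-- Sine and cosine are limits whose n-th rational term is read off at an index fixed by a Cauchy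
-- modulus, which no identity can use directly. The exponential sums, however, converge uniformly in
-- that index, so up to a null sequence the n-th term of sin x is the n-th Taylor polynomial at the
-- rational `seq x n`. Trigonometric identities thereby become identities between coefficients. The
-- inequality sin² x ≤ x² is reduced to small arguments by sin² x ≤ 4ⁿ sin² (x / 2ⁿ), where a crude
-- series estimate is enough. Both sums have to be exhibited, so convergence is proved as well:
-- |Sₖ|² is bounded uniformly in k, and 1 / k² is dominated by a telescoping sequence.

0≤-diff : ∀ {p q} → p ℚ.≤ q → 0ℚ ℚ.≤ q ℚ.- p
0≤-diff {p} {q} p≤q = subst (ℚ._≤ q ℚ.- p) (ℚP.+-inverseʳ p) (ℚP.+-monoˡ-≤ (ℚ.- p) p≤q)

diff-0≤ : ∀ {p q} → 0ℚ ℚ.≤ q ℚ.- p → p ℚ.≤ q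
diff-0≤ {p} {q} h = subst₂ ℚ._≤_ (ℚP.+-identityˡ p)
  (solve 2 (λ p q → q :- p :+ p := q) refl p q) (ℚP.+-monoˡ-≤ p h)

p≤∣p∣ : ∀ p → p ℚ.≤ ℚ.∣ p ∣
p≤∣p∣ p with ℚP.≤-total 0ℚ p
... | inj₁ 0≤p = ℚP.≤-reflexive (sym (ℚP.0≤p⇒∣p∣≡p 0≤p))
... | inj₂ p≤0 = ℚP.≤-trans p≤0 (ℚP.0≤∣p∣ p)

-p≤∣p∣ : ∀ p → ℚ.- p ℚ.≤ ℚ.∣ p ∣
-p≤∣p∣ p = subst (ℚ.- p ℚ.≤_) (ℚP.∣-p∣≡∣p∣ p) (p≤∣p∣ (ℚ.- p))

p*p≡∣p∣*∣p∣ : ∀ p → p ℚ.* p ≡ ℚ.∣ p ∣ ℚ.* ℚ.∣ p ∣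
p*p≡∣p∣*∣p∣ p with ℚP.∣p∣≡p∨∣p∣≡-p p
... | inj₁ eq = sym (cong₂ ℚ._*_ eq eq)
... | inj₂ eq = trans (solve 1 (λ p → p :* p := (:- p) :* (:- p)) refl p)
                      (sym (cong₂ ℚ._*_ eq eq))

0≤p*p : ∀ p → 0ℚ ℚ.≤ p ℚ.* p
0≤p*p p = subst (0ℚ ℚ.≤_) (sym (p*p≡∣p∣*∣p∣ p)) (*-nonneg (ℚP.0≤∣p∣ p) (ℚP.0≤∣p∣ p))

∣p*q∣≤ : ∀ {p q r s} → ℚ.∣ p ∣ ℚ.≤ r → ℚ.∣ q ∣ ℚ.≤ s → ℚ.∣ p ℚ.* q ∣ ℚ.≤ r ℚ.* s
∣p*q∣≤ {p} {q} {r} {s} p≤r q≤s = subst (ℚ._≤ r ℚ.* s) (sym (ℚP.∣p*q∣≡∣p∣*∣q∣ p q))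
  (*-mono-≤-nonneg (ℚP.≤-trans (ℚP.0≤∣p∣ p) p≤r) (ℚP.0≤∣p∣ q) p≤r q≤s)

∣p+q∣≤ : ∀ {p q r s} → ℚ.∣ p ∣ ℚ.≤ r → ℚ.∣ q ∣ ℚ.≤ s → ℚ.∣ p ℚ.+ q ∣ ℚ.≤ r ℚ.+ s
∣p+q∣≤ {p} {q} p≤r q≤s = ℚP.≤-trans (ℚP.∣p+q∣≤∣p∣+∣q∣ p q) (ℚP.+-mono-≤ p≤r q≤s)

-- Cauchy products of rational sequences

partial : (ℕ → ℚ) → ℕ → ℚ
partial a zero    = 0ℚ
partial a (suc n) = partial a n ℚ.+ a n

conv : (ℕ → ℚ) → (ℕ → ℚ) → ℕ → ℚ
conv a b zero    = a 0 ℚ.* b 0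
conv a b (suc l) = a 0 ℚ.* b (suc l) ℚ.+ conv (a ∘ suc) b l

-- Coefficients of the formal derivative of ∑ a j tʲ. Series of exponential type are identified
-- below by their differential equations, which keeps binomial coefficients out of the Cauchy
-- products.
deriv : (ℕ → ℚ) → ℕ → ℚ
deriv a j = ℕ→ℚ (suc j) ℚ.* a (suc j)

ℕ→ℚ-suc : ∀ n → ℕ→ℚ (suc n) ≡ 1ℚ ℚ.+ ℕ→ℚ n
ℕ→ℚ-suc n = ℤ→ℚ-+ (+ 1) (+ n)

conv-cong : ∀ {a a′ b b′} → (∀ j → a j ≡ a′ j) → (∀ j → b j ≡ b′ j) →
  ∀ l → conv a b l ≡ conv a′ b′ l
conv-cong f g zero    = cong₂ ℚ._*_ (f 0) (g 0)
conv-cong f g (suc l) = cong₂ ℚ._+_ (cong₂ ℚ._*_ (f 0) (g (suc l)))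
                                     (conv-cong (f ∘ suc) g l)

conv-scaleˡ : ∀ q a b l → conv (λ j → q ℚ.* a j) b l ≡ q ℚ.* conv a b l
conv-scaleˡ q a b zero    = ℚP.*-assoc q (a 0) (b 0)
conv-scaleˡ q a b (suc l) = trans
  (cong (q ℚ.* a 0 ℚ.* b (suc l) ℚ.+_) (conv-scaleˡ q (a ∘ suc) b l))
  (solve 4 (λ q a b c → q :* a :* b :+ q :* c := q :* (a :* b :+ c)) refl
    q (a 0) (b (suc l)) (conv (a ∘ suc) b l))

conv-scaleʳ : ∀ q a b l → conv a (λ j → q ℚ.* b j) l ≡ q ℚ.* conv a b l
conv-scaleʳ q a b zero    =
  solve 3 (λ q a b → a :* (q :* b) := q :* (a :* b)) refl q (a 0) (b 0)
conv-scaleʳ q a b (suc l) = trans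
  (cong (a 0 ℚ.* (q ℚ.* b (suc l)) ℚ.+_) (conv-scaleʳ q (a ∘ suc) b l))
  (solve 4 (λ q a b c → a :* (q :* b) :+ q :* c := q :* (a :* b :+ c)) refl
    q (a 0) (b (suc l)) (conv (a ∘ suc) b l))

conv-+ˡ : ∀ a a′ b l → conv (λ j → a j ℚ.+ a′ j) b l ≡ conv a b l ℚ.+ conv a′ b l
conv-+ˡ a a′ b zero    = ℚP.*-distribʳ-+ (b 0) (a 0) (a′ 0)
conv-+ˡ a a′ b (suc l) = trans
  (cong ((a 0 ℚ.+ a′ 0) ℚ.* b (suc l) ℚ.+_) (conv-+ˡ (a ∘ suc) (a′ ∘ suc) b l))
  (solve 5 (λ a a′ b c d → (a :+ a′) :* b :+ (c :+ d) := (a :* b :+ c) :+ (a′ :* b :+ d))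
    refl (a 0) (a′ 0) (b (suc l)) (conv (a ∘ suc) b l) (conv (a′ ∘ suc) b l))

-- Induction on `l`, splitting off `a 0`. Writing the factor l + 2 as 1 + (l + 1) leaves a spare
-- copy of the convolution of the shifted `a` with `b`; it supplies the constant coefficient of
-- `deriv a` and pays for the shift between `deriv (a ∘ suc)` and `deriv a ∘ suc`.
leibniz : ∀ a b l → deriv (conv a b) l ≡ conv (deriv a) b l ℚ.+ conv a (deriv b) l
leibniz a b zero =
  solve 4 (λ x y u v → con 1ℚ :* (x :* v :+ y :* u) := con 1ℚ :* y :* u :+ x :* (con 1ℚ :* v))
    refl (a 0) (a 1) (b 0) (b 1)
leibniz a b (suc l) = begin
  n₂ ℚ.* (a 0 ℚ.* b (suc (suc l)) ℚ.+ c)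
    ≡⟨ cong (λ t → t ℚ.* (a 0 ℚ.* b (suc (suc l)) ℚ.+ c)) (ℕ→ℚ-suc (suc l)) ⟩
  (1ℚ ℚ.+ n₁) ℚ.* (a 0 ℚ.* b (suc (suc l)) ℚ.+ c)
    ≡⟨ solve 5 (λ n x y c d → (con 1ℚ :+ n) :* (x :* y :+ c) :=
         (con 1ℚ :+ n) :* (x :* y) :+ c :+ n :* c) refl n₁ (a 0) (b (suc (suc l))) c n₁ ⟩
  (1ℚ ℚ.+ n₁) ℚ.* (a 0 ℚ.* b (suc (suc l))) ℚ.+ c ℚ.+ n₁ ℚ.* c
    ≡⟨ cong₂ (λ t u → t ℚ.* (a 0 ℚ.* b (suc (suc l))) ℚ.+ c ℚ.+ u)
         (sym (ℕ→ℚ-suc (suc l))) (leibniz (a ∘ suc) b l) ⟩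
  n₂ ℚ.* (a 0 ℚ.* b (suc (suc l))) ℚ.+ (a 1 ℚ.* b (suc l) ℚ.+ s)
    ℚ.+ (conv (deriv (a ∘ suc)) b l ℚ.+ conv (a ∘ suc) (deriv b) l)
    ≡⟨ solve 8 (λ n x y a₁ b₁ s d e → n :* (x :* y) :+ (a₁ :* b₁ :+ s) :+ (d :+ e)
          := con 1ℚ :* a₁ :* b₁ :+ (d :+ s) :+ (x :* (n :* y) :+ e)) refl
         n₂ (a 0) (b (suc (suc l))) (a 1) (b (suc l)) s
         (conv (deriv (a ∘ suc)) b l) (conv (a ∘ suc) (deriv b) l) ⟩
  1ℚ ℚ.* a 1 ℚ.* b (suc l) ℚ.+ (conv (deriv (a ∘ suc)) b l ℚ.+ s)
    ℚ.+ conv a (deriv b) (suc l)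
    ≡⟨ cong (λ t → 1ℚ ℚ.* a 1 ℚ.* b (suc l) ℚ.+ t ℚ.+ conv a (deriv b) (suc l))
         (sym (trans (conv-cong shift (λ _ → refl) l)
                (conv-+ˡ (deriv (a ∘ suc)) (a ∘ suc ∘ suc) b l))) ⟩
  conv (deriv a) b (suc l) ℚ.+ conv a (deriv b) (suc l) ∎
  where
  open ≡-Reasoning
  n₁ = ℕ→ℚ (suc l)
  n₂ = ℕ→ℚ (suc (suc l))
  c = conv (a ∘ suc) b (suc l)
  s = conv (a ∘ suc ∘ suc) b l
  shift : ∀ j → deriv a (suc j) ≡ deriv (a ∘ suc) j ℚ.+ a (suc (suc j))
  shift j = trans (cong (ℚ._* a (suc (suc j))) (ℕ→ℚ-suc (suc j)))
    (solve 2 (λ n x → (con 1ℚ :+ n) :* x := n :* x :+ x) refl (ℕ→ℚ (suc j)) (a (suc (suc j))))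

-- The part i + j < n of the product of two series.
triangle : ℕ → (ℕ → ℚ) → (ℕ → ℚ) → ℚ
triangle zero    a b = 0ℚ
triangle (suc n) a b = a 0 ℚ.* partial b (suc n) ℚ.+ triangle n (a ∘ suc) b

triangle-suc : ∀ n a b → triangle (suc n) a b ≡ triangle n a b ℚ.+ conv a b n
triangle-suc zero a b =
  solve 2 (λ x y → x :* (con 0ℚ :+ y) :+ con 0ℚ := con 0ℚ :+ x :* y) refl (a 0) (b 0)
triangle-suc (suc n) a b = trans
  (cong (a 0 ℚ.* partial b (suc (suc n)) ℚ.+_) (triangle-suc n (a ∘ suc) b))
  (solve 5 (λ x p y t c → x :* (p :+ y) :+ (t :+ c) := (x :* p :+ t) :+ (x :* y :+ c)) refl
    (a 0) (partial b (suc n)) (b (suc n)) (triangle n (a ∘ suc) b) (conv (a ∘ suc) b n))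

triangle≡partial-conv : ∀ n a b → triangle n a b ≡ partial (conv a b) n
triangle≡partial-conv zero    a b = refl
triangle≡partial-conv (suc n) a b = trans (triangle-suc n a b)
  (cong (ℚ._+ conv a b n) (triangle≡partial-conv n a b))

partial-cons : ∀ a n → partial a (suc n) ≡ a 0 ℚ.+ partial (a ∘ suc) n
partial-cons a zero    = ℚP.+-comm 0ℚ (a 0)
partial-cons a (suc n) = trans (cong (ℚ._+ a (suc n)) (partial-cons a n))
  (ℚP.+-assoc (a 0) (partial (a ∘ suc) n) (a (suc n)))

partial-cong : ∀ {a b} → (∀ j → a j ≡ b j) → ∀ n → partial a n ≡ partial b n
partial-cong f zero    = refl
partial-cong f (suc n) = cong₂ ℚ._+_ (partial-cong f n) (f n)

partial-≤ : ∀ {u} → (∀ j → 0ℚ ℚ.≤ u j) → ∀ d n → partial u n ℚ.≤ partial u (d ℕ.+ n)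
partial-≤ h zero    n = ℚP.≤-refl
partial-≤ h (suc d) n = ℚP.≤-trans (partial-≤ h d n) (p≤p+q (h (d ℕ.+ n)))

partial-nonneg : ∀ {u} → (∀ j → 0ℚ ℚ.≤ u j) → ∀ n → 0ℚ ℚ.≤ partial u n
partial-nonneg h zero    = ℚP.≤-refl
partial-nonneg h (suc n) = ℚP.+-mono-≤ (partial-nonneg h n) (h n)

module _ {b v : ℕ → ℚ} (b≤v : ∀ j → ℚ.∣ b j ∣ ℚ.≤ v j) where

  partial-dominated : ∀ d n →
    ℚ.∣ partial b (d ℕ.+ n) ℚ.- partial b n ∣ ℚ.≤ partial v (d ℕ.+ n) ℚ.- partial v n
  partial-dominated zero n = subst₂ ℚ._≤_
    (sym (cong ℚ.∣_∣ (ℚP.+-inverseʳ (partial b n))))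
    (sym (ℚP.+-inverseʳ (partial v n))) ℚP.≤-refl
  partial-dominated (suc d) n = subst₂ ℚ._≤_
    (cong ℚ.∣_∣ (move (partial b (d ℕ.+ n)) (partial b n) (b (d ℕ.+ n))))
    (move (partial v (d ℕ.+ n)) (partial v n) (v (d ℕ.+ n)))
    (∣p+q∣≤ {partial b (d ℕ.+ n) ℚ.- partial b n} (partial-dominated d n) (b≤v (d ℕ.+ n)))
    where
    move : ∀ p q r → (p ℚ.- q) ℚ.+ r ≡ (p ℚ.+ r) ℚ.- q
    move = solve 3 (λ p q r → (p :- q) :+ r := (p :+ r) :- q) refl

  -- Both sides run over the same index pairs, those of the n by d + n rectangle outside the
  -- triangle i + j < n, so the bound is termwise. The rectangle is there for the induction:
  -- removing the row of `a 0` shortens one side only and raises `d` by one.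
  square-triangle-dominated : ∀ {a u : ℕ → ℚ} → (∀ j → ℚ.∣ a j ∣ ℚ.≤ u j) → ∀ n d →
    ℚ.∣ partial a n ℚ.* partial b (d ℕ.+ n) ℚ.- triangle n a b ∣ ℚ.≤
    partial u n ℚ.* partial v (d ℕ.+ n) ℚ.- triangle n u v
  square-triangle-dominated {a} {u} a≤u zero d = subst₂ ℚ._≤_
    (sym (cong ℚ.∣_∣ (zero-case (partial b (d ℕ.+ 0)))))
    (sym (zero-case (partial v (d ℕ.+ 0)))) ℚP.≤-refl
    where
    zero-case : ∀ p → 0ℚ ℚ.* p ℚ.- 0ℚ ≡ 0ℚ
    zero-case = solve 1 (λ p → con 0ℚ :* p :- con 0ℚ := con 0ℚ) refl
  square-triangle-dominated {a} {u} a≤u (suc n) d = subst₂ ℚ._≤_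
    (cong ℚ.∣_∣ (split a b)) (split u v)
    (∣p+q∣≤ {a 0 ℚ.* (partial b (d ℕ.+ suc n) ℚ.- partial b (suc n))}
      (∣p*q∣≤ {a 0} {partial b (d ℕ.+ suc n) ℚ.- partial b (suc n)} {u 0}
        (a≤u 0) (partial-dominated d (suc n)))
      (subst (λ m → ℚ.∣ partial (a ∘ suc) n ℚ.* partial b m ℚ.- triangle n (a ∘ suc) b ∣ ℚ.≤
                    partial (u ∘ suc) n ℚ.* partial v m ℚ.- triangle n (u ∘ suc) v)
        (sym (ℕP.+-suc d n)) (square-triangle-dominated (a≤u ∘ suc) n (suc d))))
    where
    split : ∀ a b →
      a 0 ℚ.* (partial b (d ℕ.+ suc n) ℚ.- partial b (suc n)) ℚ.+
        (partial (a ∘ suc) n ℚ.* partial b (d ℕ.+ suc n) ℚ.- triangle n (a ∘ suc) b) ≡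
      partial a (suc n) ℚ.* partial b (d ℕ.+ suc n) ℚ.- triangle (suc n) a b
    split a b = trans
      (solve 5 (λ x B p q t → x :* (B :- p) :+ (q :* B :- t) := (x :+ q) :* B :- (x :* p :+ t))
        refl (a 0) (partial b (d ℕ.+ suc n)) (partial b (suc n)) (partial (a ∘ suc) n)
        (triangle n (a ∘ suc) b))
      (cong (λ t → t ℚ.* partial b (d ℕ.+ suc n) ℚ.- triangle (suc n) a b)
        (sym (partial-cons a n)))

triangle-nonneg : ∀ {u v} → (∀ j → 0ℚ ℚ.≤ u j) → (∀ j → 0ℚ ℚ.≤ v j) → ∀ n →
  0ℚ ℚ.≤ triangle n u v
triangle-nonneg hu hv zero    = ℚP.≤-refl
triangle-nonneg hu hv (suc n) = ℚP.+-mono-≤ (*-nonneg (hu 0) (partial-nonneg hv (suc n)))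
                                            (triangle-nonneg (hu ∘ suc) hv n)

-- The rectangle i < n, j < m lies inside the triangle i + j < n + m, and all terms are nonnegative.
square≤triangle : ∀ {u v} → (∀ j → 0ℚ ℚ.≤ u j) → (∀ j → 0ℚ ℚ.≤ v j) → ∀ n m →
  partial u n ℚ.* partial v m ℚ.≤ triangle (n ℕ.+ m) u v
square≤triangle {u} {v} hu hv zero m =
  subst (ℚ._≤ triangle m u v) (sym (ℚP.*-zeroˡ (partial v m))) (triangle-nonneg hu hv m)
square≤triangle {u} {v} hu hv (suc n) m = subst (ℚ._≤ triangle (suc n ℕ.+ m) u v)
  (trans (sym (ℚP.*-distribʳ-+ (partial v m) (u 0) (partial (u ∘ suc) n)))
    (cong (ℚ._* partial v m) (sym (partial-cons u n))))
  (ℚP.+-mono-≤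
    (ℚP.*-monoˡ-≤-nonNeg (u 0) {{ℚ.nonNegative (hu 0)}} (partial-≤ hv (suc n) m))
    (square≤triangle (hu ∘ suc) hv n m))

majorant-deriv : ∀ A j → deriv (majorant A) j ≡ ℕ→ℚ (A ℕ.+ A) ℚ.* majorant A j
majorant-deriv A j = trans
  (sym (ℚP.*-assoc (ℕ→ℚ (suc j)) (recip j) (ℕ→ℚ (A ℕ.+ A) ℚ.* majorant A j)))
  (trans (cong (ℚ._* (ℕ→ℚ (A ℕ.+ A) ℚ.* majorant A j)) (suc*recip j)) (ℚP.*-identityˡ _))

suc*-cancel : ∀ j {x y} → ℕ→ℚ (suc j) ℚ.* x ≡ y → x ≡ recip j ℚ.* y
suc*-cancel j {x} {y} eq = trans (sym (ℚP.*-identityˡ x))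
  (trans (cong (ℚ._* x) (sym (suc*recip j)))
  (trans (solve 3 (λ n r x → n :* r :* x := r :* (n :* x)) refl (ℕ→ℚ (suc j)) (recip j) x)
    (cong (recip j ℚ.*_) eq)))

-- Coefficient form of exp (2At)² = exp (4At): by `leibniz` the square obeys the recurrence that
-- defines `majorant (A ℕ.+ A)`.
conv-majorant : ∀ A l → conv (majorant A) (majorant A) l ≡ majorant (A ℕ.+ A) l
conv-majorant A zero    = refl
conv-majorant A (suc l) = suc*-cancel l (begin
  deriv (conv u u) l
    ≡⟨ leibniz u u l ⟩
  conv (deriv u) u l ℚ.+ conv u (deriv u) l
    ≡⟨ cong₂ ℚ._+_
         (trans (conv-cong (majorant-deriv A) (λ _ → refl) l) (conv-scaleˡ C u u l))
         (trans (conv-cong (λ _ → refl) (majorant-deriv A) l) (conv-scaleʳ C u u l)) ⟩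
  C ℚ.* conv u u l ℚ.+ C ℚ.* conv u u l
    ≡⟨ sym (ℚP.*-distribʳ-+ (conv u u l) C C) ⟩
  (C ℚ.+ C) ℚ.* conv u u l
    ≡⟨ cong₂ ℚ._*_ (sym (ℤ→ℚ-+ (+ (A ℕ.+ A)) (+ (A ℕ.+ A)))) (conv-majorant A l) ⟩
  ℕ→ℚ ((A ℕ.+ A) ℕ.+ (A ℕ.+ A)) ℚ.* majorant (A ℕ.+ A) l ∎)
  where
  open ≡-Reasoning
  u = majorant A
  C = ℕ→ℚ (A ℕ.+ A)

tail≡ : ∀ A n d → partial (majorant A) (d ℕ.+ n) ℚ.- partial (majorant A) n ≡ tail A n d
tail≡ A n zero    = ℚP.+-inverseʳ (partial (majorant A) n)
tail≡ A n (suc d) = trans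
  (solve 3 (λ p r q → (p :+ r) :- q := (p :- q) :+ r) refl
    (partial (majorant A) (d ℕ.+ n)) (majorant A (d ℕ.+ n)) (partial (majorant A) n))
  (cong (ℚ._+ majorant A (d ℕ.+ n)) (tail≡ A n d))

-- The error is at most that of the majorants. There the square of side n fits into the triangle of
-- size 2n, and the difference of the triangles of sizes 2n and n is a tail of an exponential
-- series, which `tail-small` controls.
square-conv-close : ∀ A {a b} →
  (∀ j → ℚ.∣ a j ∣ ℚ.≤ majorant A j) → (∀ j → ℚ.∣ b j ∣ ℚ.≤ majorant A j) → ∀ n →
  ℚ.∣ partial a n ℚ.* partial b n ℚ.- partial (conv a b) n ∣ ℚ.≤ tail (A ℕ.+ A) n n
square-conv-close A {a} {b} ha hb n = subst₂ ℚ._≤_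
  (cong (λ t → ℚ.∣ partial a n ℚ.* partial b n ℚ.- t ∣) (triangle≡partial-conv n a b))
  (tail≡ (A ℕ.+ A) n n)
  (ℚP.≤-trans (square-triangle-dominated hb ha n 0)
    (ℚP.+-mono-≤
      (subst (partial u n ℚ.* partial u n ℚ.≤_) (tri (n ℕ.+ n)) (square≤triangle 0≤u 0≤u n n))
      (ℚP.≤-reflexive (cong ℚ.-_ (tri n)))))
  where
  u = majorant A
  0≤u = majorant-nonneg A
  tri : ∀ m → triangle m u u ≡ partial (majorant (A ℕ.+ A)) m
  tri m = trans (triangle≡partial-conv m u u) (partial-cong (conv-majorant A) m)

-- Asymptotic comparison of rational sequences

Null : (ℕ → ℚ) → Set
Null f = ∀ ε → 0ℚ ℚ.< ε → ∃ λ N → ∀ n → N ℕ.≤ n → ℚ.∣ f n ∣ ℚ.≤ ε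

-- A record rather than a function, so that f can be inferred.
record NonNeg (f : ℕ → ℚ) : Set where
  constructor nonneg
  field
    0≤f+ε : ∀ ε → 0ℚ ℚ.< ε → ∃ λ N → ∀ n → N ℕ.≤ n → 0ℚ ℚ.≤ f n ℚ.+ ε

open NonNeg public

null-ext : ∀ {f g} → Null f → (∀ n → f n ≡ g n) → Null g
null-ext nf eq ε 0<ε = let (N , h) = nf ε 0<ε in
  N , λ n p → subst (λ t → ℚ.∣ t ∣ ℚ.≤ ε) (eq n) (h n p)

≡⇒null : ∀ {f} → (∀ n → f n ≡ 0ℚ) → Null f
≡⇒null eq ε 0<ε = 0 , λ n _ → subst (λ t → ℚ.∣ t ∣ ℚ.≤ ε) (sym (eq n)) (ℚP.<⇒≤ 0<ε)

null-dominated : ∀ {f g} → (∃ λ N → ∀ n → N ℕ.≤ n → ℚ.∣ f n ∣ ℚ.≤ ℚ.∣ g n ∣) →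
  Null g → Null f
null-dominated (M , d) ng ε 0<ε = let (N , h) = ng ε 0<ε in
  M ℕ.⊔ N , λ n p → ℚP.≤-trans (d n (ℕP.m⊔n≤o⇒m≤o M N p)) (h n (ℕP.m⊔n≤o⇒n≤o M N p))

null-+ : ∀ {f g} → Null f → Null g → Null (λ n → f n ℚ.+ g n)
null-+ {f} nf ng ε 0<ε =
  let (M , h) = nf (half ε) (half-pos 0<ε)
      (N , k) = ng (half ε) (half-pos 0<ε)
  in M ℕ.⊔ N , λ n p → subst (_ ℚ.≤_) (half+half ε)
       (∣p+q∣≤ {f n} (h n (ℕP.m⊔n≤o⇒m≤o M N p)) (k n (ℕP.m⊔n≤o⇒n≤o M N p)))

null-*ˡ : ∀ x {f} → Null f → Null (λ n → seq x n ℚ.* f n)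
null-*ˡ x {f} nf ε 0<ε =
  let (B , M , b) = eventually-bounded x
      (N , h) = nf (ε ℚ.* recip B) (*-pos 0<ε (recip-pos B))
  in M ℕ.⊔ N , λ n p → subst (_ ℚ.≤_) (scale-cancel B ε)
       (∣p*q∣≤ {seq x n} {f n} (b n (ℕP.m⊔n≤o⇒m≤o M N p)) (h n (ℕP.m⊔n≤o⇒n≤o M N p)))

null-** : ∀ {f g} → Null f → Null g → Null (λ n → f n ℚ.* g n)
null-** {f} {g} nf ng ε 0<ε =
  let (M , h) = nf 1ℚ (ℚP.positive⁻¹ 1ℚ)
      (N , k) = ng ε 0<ε
  in M ℕ.⊔ N , λ n p → subst (_ ℚ.≤_) (ℚP.*-identityˡ ε)
       (∣p*q∣≤ {f n} {g n} (h n (ℕP.m⊔n≤o⇒m≤o M N p)) (k n (ℕP.m⊔n≤o⇒n≤o M N p)))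

null-neg : ∀ {f} → Null f → Null (λ n → ℚ.- f n)
null-neg {f} nf = null-dominated {g = f} (0 , λ n _ → ℚP.≤-reflexive (ℚP.∣-p∣≡∣p∣ (f n))) nf

null-- : ∀ {f g} → Null f → Null g → Null (λ n → f n ℚ.- g n)
null-- nf ng = null-+ nf (null-neg ng)

nonneg-ext : ∀ {f g} → NonNeg f → (∀ n → f n ≡ g n) → NonNeg g
nonneg-ext nf eq = nonneg λ ε 0<ε → let (N , h) = 0≤f+ε nf ε 0<ε in
  N , λ n p → subst (λ t → 0ℚ ℚ.≤ t ℚ.+ ε) (eq n) (h n p)

eventually⇒nonneg : ∀ {f} → (∃ λ N → ∀ n → N ℕ.≤ n → 0ℚ ℚ.≤ f n) → NonNeg f
eventually⇒nonneg (N , h) = nonneg λ ε 0<ε →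
  N , λ n p → ℚP.≤-trans (h n p) (p≤p+q (ℚP.<⇒≤ 0<ε))

pointwise⇒nonneg : ∀ {f} → (∀ n → 0ℚ ℚ.≤ f n) → NonNeg f
pointwise⇒nonneg h = eventually⇒nonneg (0 , λ n _ → h n)

null⇒nonneg : ∀ {f} → Null f → NonNeg f
null⇒nonneg {f} nf = nonneg λ ε 0<ε → let (N , h) = nf ε 0<ε in
  N , λ n p → subst (ℚ._≤ f n ℚ.+ ε) (ℚP.+-inverseʳ (f n))
    (ℚP.+-monoʳ-≤ (f n) (ℚP.≤-trans (-p≤∣p∣ (f n)) (h n p)))

nonneg-+ : ∀ {f g} → NonNeg f → NonNeg g → NonNeg (λ n → f n ℚ.+ g n)
nonneg-+ {f} {g} nf ng = nonneg λ ε 0<ε →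
  let (M , h) = 0≤f+ε nf (half ε) (half-pos 0<ε)
      (N , k) = 0≤f+ε ng (half ε) (half-pos 0<ε)
  in M ℕ.⊔ N , λ n p → subst (0ℚ ℚ.≤_)
       (trans (solve 3 (λ f g e → (f :+ e) :+ (g :+ e) := (f :+ g) :+ (e :+ e)) refl
                (f n) (g n) (half ε))
              (cong (f n ℚ.+ g n ℚ.+_) (half+half ε)))
       (ℚP.+-mono-≤ (h n (ℕP.m⊔n≤o⇒m≤o M N p)) (k n (ℕP.m⊔n≤o⇒n≤o M N p)))

nonneg-*ˡ : ∀ x {f} → (∀ n → 0ℚ ℚ.≤ seq x n) → NonNeg f → NonNeg (λ n → seq x n ℚ.* f n)
nonneg-*ˡ x {f} 0≤x nf = nonneg λ ε 0<ε →
  let (B , M , b) = eventually-bounded x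
      e = ε ℚ.* recip B
      0<e = *-pos 0<ε (recip-pos B)
      (N , h) = 0≤f+ε nf e 0<e
  in M ℕ.⊔ N , λ n p → ℚP.≤-trans (*-nonneg (0≤x n) (h n (ℕP.m⊔n≤o⇒n≤o M N p)))
       (subst (ℚ._≤ seq x n ℚ.* f n ℚ.+ ε) (sym (ℚP.*-distribˡ-+ (seq x n) (f n) e))
         (ℚP.+-monoʳ-≤ (seq x n ℚ.* f n)
           (subst (seq x n ℚ.* e ℚ.≤_) (scale-cancel B ε)
             (ℚP.*-monoʳ-≤-nonNeg e {{ℚ.nonNegative (ℚP.<⇒≤ 0<e)}}
               (ℚP.≤-trans (p≤∣p∣ (seq x n)) (b n (ℕP.m⊔n≤o⇒m≤o M N p)))))))

nonneg-closed : ∀ {f} → (∀ ε → 0ℚ ℚ.< ε → NonNeg (λ n → f n ℚ.+ ε)) → NonNeg f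
nonneg-closed {f} h = nonneg λ ε 0<ε →
  let (N , k) = 0≤f+ε (h (half ε) (half-pos 0<ε)) (half ε) (half-pos 0<ε)
  in N , λ n p → subst (0ℚ ℚ.≤_)
       (trans (ℚP.+-assoc (f n) (half ε) (half ε)) (cong (f n ℚ.+_) (half+half ε))) (k n p)

≤⇒nonneg : ∀ x y → x ≤ y → NonNeg (λ n → seq y n ℚ.- seq x n)
≤⇒nonneg x y x≤y = nonneg λ ε 0<ε → let (N , h) = x≤y ε 0<ε in
  N , λ n p → subst (0ℚ ℚ.≤_)
    (solve 3 (λ x y e → (y :+ e) :- x := (y :- x) :+ e) refl (seq x n) (seq y n) ε)
    (0≤-diff (h n p))

nonneg⇒≤ : ∀ x y → NonNeg (λ n → seq y n ℚ.- seq x n) → x ≤ y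
nonneg⇒≤ x y h ε 0<ε = let (N , k) = 0≤f+ε h ε 0<ε in
  N , λ n p → diff-0≤ (subst (0ℚ ℚ.≤_)
    (solve 3 (λ x y e → (y :- x) :+ e := (y :+ e) :- x) refl (seq x n) (seq y n) ε)
    (k n p))

-- Replaces the index chosen by `lim` with n itself. The path goes from `approx f n` to f n at a
-- large k, to the fixed f M at k, to f M at n, and back to f n at n, each step costing ε / 4. Since
-- M does not depend on n, neither does the Cauchy threshold `L` of f M; uniformity in the inner
-- index covers the two changes between f n and f M.
lim-diagonal : ∀ f (c : Cauchy f) →
  (∀ ε → 0ℚ ℚ.< ε → ∃ λ M → ∃ λ K → ∀ m n k → M ℕ.≤ m → M ℕ.≤ n → K ℕ.≤ k →
    ℚ.∣ seq (f m) k ℚ.- seq (f n) k ∣ ℚ.≤ ε) →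
  Null (λ n → seq (lim f c) n ℚ.- seq (f n) n)
lim-diagonal f c uniform ε 0<ε =
  let e = half (half ε)
      0<e = half-pos (half-pos 0<ε)
      (A , a) = archimedean e 0<e
      (M , K , u) = uniform e 0<e
      (L , l) = cauchy (f M) e 0<e
  in A ℕ.⊔ (M ℕ.⊔ (K ℕ.⊔ L)) , λ n p →
    let A≤n = ℕP.m⊔n≤o⇒m≤o A _ p
        q = ℕP.m⊔n≤o⇒n≤o A (M ℕ.⊔ (K ℕ.⊔ L)) p
        M≤n = ℕP.m⊔n≤o⇒m≤o M _ q
        r = ℕP.m⊔n≤o⇒n≤o M (K ℕ.⊔ L) q
        K≤n = ℕP.m⊔n≤o⇒m≤o K _ r
        L≤n = ℕP.m⊔n≤o⇒n≤o K L r
        k = modulus f n ℕ.⊔ n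
        n≤k = ℕP.m≤n⊔m (modulus f n) n
        s₁ = ℚP.≤-trans (approx-close f n k (ℕP.m≤m⊔n (modulus f n) n)) (a n A≤n)
        s₂ = u n M k M≤n ℕP.≤-refl (ℕP.≤-trans K≤n n≤k)
        s₃ = l k n (ℕP.≤-trans L≤n n≤k) L≤n
        s₄ = u M n n ℕP.≤-refl M≤n K≤n
        x₀ = approx f n
        x₁ = seq (f n) k
        x₂ = seq (f M) k
        x₃ = seq (f M) n
        x₄ = seq (f n) n
    in subst₂ (λ t s → ℚ.∣ t ∣ ℚ.≤ s)
         (solve 5 (λ x₀ x₁ x₂ x₃ x₄ → ((x₀ :- x₁) :+ (x₁ :- x₂)) :+ ((x₂ :- x₃) :+ (x₃ :- x₄))
           := x₀ :- x₄) refl x₀ x₁ x₂ x₃ x₄)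
         (trans (cong₂ ℚ._+_ (half+half (half ε)) (half+half (half ε))) (half+half ε))
         (∣p+q∣≤ {(x₀ ℚ.- x₁) ℚ.+ (x₁ ℚ.- x₂)} {(x₂ ℚ.- x₃) ℚ.+ (x₃ ℚ.- x₄)}
           (∣p+q∣≤ {x₀ ℚ.- x₁} {x₁ ℚ.- x₂} s₁ s₂)
           (∣p+q∣≤ {x₂ ℚ.- x₃} {x₃ ℚ.- x₄} s₃ s₄))

-- Sine and cosine

-- Real and imaginary part of (iq)ʲ / j!, vanishing terms included. The indices then match
-- `expTerm`, and the two obey the coupled equations c′ = -q s and s′ = q c.
cosTerm sinTerm : ℚ → ℕ → ℚ
cosTerm q zero    = 1ℚ
cosTerm q (suc j) = recip j ℚ.* (ℚ.- q ℚ.* sinTerm q j)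
sinTerm q zero    = 0ℚ
sinTerm q (suc j) = recip j ℚ.* (q ℚ.* cosTerm q j)

cos : ℝ → ℝ
cos x = re (exp (mkℂ (ι 0ℚ) x))

expTerm-imaginary : ∀ x k j →
  seq (re (expTerm (mkℂ (ι 0ℚ) x) j)) k ≡ cosTerm (seq x k) j ×
  seq (im (expTerm (mkℂ (ι 0ℚ) x) j)) k ≡ sinTerm (seq x k) j
expTerm-imaginary x k zero    = refl , refl
expTerm-imaginary x k (suc j) =
  let (hc , hs) = expTerm-imaginary x k j
      q = seq x k
      c = seq (re (expTerm (mkℂ (ι 0ℚ) x) j)) k
      s = seq (im (expTerm (mkℂ (ι 0ℚ) x) j)) k
      r = recip j
  in trans (solve 4 (λ r q c s → r :* (con 0ℚ :* c :- q :* s) :- con 0ℚ :* (con 0ℚ :* s :+ q :* c)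
             := r :* ((:- q) :* s)) refl r q c s) (cong (λ t → r ℚ.* (ℚ.- q ℚ.* t)) hs)
   , trans (solve 4 (λ r q c s → r :* (con 0ℚ :* s :+ q :* c) :+ con 0ℚ :* (con 0ℚ :* c :- q :* s)
             := r :* (q :* c)) refl r q c s) (cong (λ t → r ℚ.* (q ℚ.* t)) hc)

expSum-imaginary : ∀ x k n →
  seq (re (expSum (mkℂ (ι 0ℚ) x) n)) k ≡ partial (cosTerm (seq x k)) n ×
  seq (im (expSum (mkℂ (ι 0ℚ) x) n)) k ≡ partial (sinTerm (seq x k)) n
expSum-imaginary x k zero    = refl , refl
expSum-imaginary x k (suc n) =
  let (hc , hs) = expSum-imaginary x k n
      (tc , ts) = expTerm-imaginary x k n
  in cong₂ ℚ._+_ hc tc , cong₂ ℚ._+_ hs ts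

module _ (A : ℕ) {q : ℚ} (q≤A : ℚ.∣ q ∣ ℚ.≤ ℕ→ℚ A) where

  cosTerm-bound : ∀ j → ℚ.∣ cosTerm q j ∣ ℚ.≤ majorant A j
  cosTerm-bound j = subst (λ t → ℚ.∣ t ∣ ℚ.≤ majorant A j) (proj₁ (expTerm-imaginary (ι q) 0 j))
    (proj₁ (expTerm-bound A (mkℂ (ι 0ℚ) (ι q)) 0 (ℕ→ℚ-nonneg A) q≤A j))

  sinTerm-bound : ∀ j → ℚ.∣ sinTerm q j ∣ ℚ.≤ majorant A j
  sinTerm-bound j = subst (λ t → ℚ.∣ t ∣ ℚ.≤ majorant A j) (proj₂ (expTerm-imaginary (ι q) 0 j))
    (proj₂ (expTerm-bound A (mkℂ (ι 0ℚ) (ι q)) 0 (ℕ→ℚ-nonneg A) q≤A j))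

partial-uniform : ∀ A {a : ℕ → ℚ} → (∀ j → ℚ.∣ a j ∣ ℚ.≤ majorant A j) →
  ∀ {ε N} → (∀ n d → N ℕ.≤ n → tail A n d ℚ.≤ ε) →
  ∀ m n → N ℕ.≤ m → N ℕ.≤ n → ℚ.∣ partial a m ℚ.- partial a n ∣ ℚ.≤ ε
partial-uniform A {a} ha {ε} {N} small = both
  where
  ordered : ∀ m n → N ℕ.≤ n → n ℕ.≤ m → ℚ.∣ partial a m ℚ.- partial a n ∣ ℚ.≤ ε
  ordered m n N≤n n≤m = subst (λ i → ℚ.∣ partial a i ℚ.- partial a n ∣ ℚ.≤ ε) (ℕP.m∸n+n≡m n≤m)
    (ℚP.≤-trans (partial-dominated ha (m ℕ.∸ n) n)
      (subst (ℚ._≤ ε) (sym (tail≡ A n (m ℕ.∸ n))) (small n (m ℕ.∸ n) N≤n)))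
  both : ∀ m n → N ℕ.≤ m → N ℕ.≤ n → ℚ.∣ partial a m ℚ.- partial a n ∣ ℚ.≤ ε
  both m n N≤m N≤n with ℕP.≤-total n m
  ... | inj₁ n≤m = ordered m n N≤n n≤m
  ... | inj₂ m≤n = subst (ℚ._≤ ε) (∣p-q∣≡∣q-p∣ (partial a n) (partial a m)) (ordered n m N≤m m≤n)

module _ (x : ℝ) where

  private
    B = proj₁ (eventually-bounded x)
    K = proj₁ (proj₂ (eventually-bounded x))
    b = proj₂ (proj₂ (eventually-bounded x))

    diagonal : (part : ℂ → ℝ) (term : ℚ → ℕ → ℚ)
      (c : Cauchy (λ n → part (expSum (mkℂ (ι 0ℚ) x) n))) →
      (∀ k n → seq (part (expSum (mkℂ (ι 0ℚ) x) n)) k ≡ partial (term (seq x k)) n) →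
      (∀ {q} → ℚ.∣ q ∣ ℚ.≤ ℕ→ℚ (suc B) → ∀ j → ℚ.∣ term q j ∣ ℚ.≤ majorant (suc B) j) →
      Null (λ n → seq (lim (λ n → part (expSum (mkℂ (ι 0ℚ) x) n)) c) n ℚ.-
                  partial (term (seq x n)) n)
    diagonal part term c eq bound = null-ext
      (lim-diagonal f c λ ε 0<ε →
        let (M , small) = tail-small (suc B) ε 0<ε
        in M , K , λ m n k M≤m M≤n K≤k →
          subst₂ (λ s t → ℚ.∣ s ℚ.- t ∣ ℚ.≤ ε) (sym (eq k m)) (sym (eq k n))
            (partial-uniform (suc B) (bound (b k K≤k)) small m n M≤m M≤n))
      (λ n → cong (λ t → seq (lim f c) n ℚ.- t) (eq n n))
      where f = λ n → part (expSum (mkℂ (ι 0ℚ) x) n)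

  -- The bridge from the reals to rational Taylor polynomials: results on `cos` and `sin` below
  -- start from this and from `sin-diagonal`.
  cos-diagonal : Null (λ n → seq (cos x) n ℚ.- partial (cosTerm (seq x n)) n)
  cos-diagonal = diagonal re cosTerm (proj₁ (expSum-cauchy (mkℂ (ι 0ℚ) x)))
    (λ k n → proj₁ (expSum-imaginary x k n)) (cosTerm-bound (suc B))

  sin-diagonal : Null (λ n → seq (sin x) n ℚ.- partial (sinTerm (seq x n)) n)
  sin-diagonal = diagonal im sinTerm (proj₂ (expSum-cauchy (mkℂ (ι 0ℚ) x)))
    (λ k n → proj₂ (expSum-imaginary x k n)) (sinTerm-bound (suc B))

-- Arguments need only agree pointwise, which covers every ring identity
-- between arguments.
module _ {x y : ℝ} (x≡y : ∀ n → seq x n ≡ seq y n) where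

  cos-cong : cos x ≈ cos y
  cos-cong = null-ext
    (null-- (cos-diagonal x) (cos-diagonal y))
    (λ n → trans (cong (λ t → (seq (cos x) n ℚ.- partial (cosTerm (seq x n)) n) ℚ.-
                     (seq (cos y) n ℚ.- partial (cosTerm t) n)) (sym (x≡y n)))
      (solve 3 (λ a b c → (a :- c) :- (b :- c) := a :- b) refl
        (seq (cos x) n) (seq (cos y) n) (partial (cosTerm (seq x n)) n)))

  sin-cong : sin x ≈ sin y
  sin-cong = null-ext
    (null-- (sin-diagonal x) (sin-diagonal y))
    (λ n → trans (cong (λ t → (seq (sin x) n ℚ.- partial (sinTerm (seq x n)) n) ℚ.-
                     (seq (sin y) n ℚ.- partial (sinTerm t) n)) (sym (x≡y n)))
      (solve 3 (λ a b c → (a :- c) :- (b :- c) := a :- b) refl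
        (seq (sin x) n) (seq (sin y) n) (partial (sinTerm (seq x n)) n)))

-- Addition formulas

cosTerm-deriv : ∀ q j → deriv (cosTerm q) j ≡ ℚ.- q ℚ.* sinTerm q j
cosTerm-deriv q j = trans (sym (ℚP.*-assoc (ℕ→ℚ (suc j)) (recip j) _))
  (trans (cong (ℚ._* (ℚ.- q ℚ.* sinTerm q j)) (suc*recip j)) (ℚP.*-identityˡ _))

sinTerm-deriv : ∀ q j → deriv (sinTerm q) j ≡ q ℚ.* cosTerm q j
sinTerm-deriv q j = trans (sym (ℚP.*-assoc (ℕ→ℚ (suc j)) (recip j) _))
  (trans (cong (ℚ._* (q ℚ.* cosTerm q j)) (suc*recip j)) (ℚP.*-identityˡ _))

module _ {a b a′ b′ : ℕ → ℚ} (p q : ℚ)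
  (da : ∀ j → deriv a j ≡ p ℚ.* a′ j) (db : ∀ j → deriv b j ≡ q ℚ.* b′ j) where

  deriv-conv : ∀ l → ℕ→ℚ (suc l) ℚ.* conv a b (suc l) ≡ p ℚ.* conv a′ b l ℚ.+ q ℚ.* conv a b′ l
  deriv-conv l = trans (leibniz a b l) (cong₂ ℚ._+_
    (trans (conv-cong da (λ _ → refl) l) (conv-scaleˡ p a′ b l))
    (trans (conv-cong (λ _ → refl) db l) (conv-scaleʳ q a b′ l)))

-- Both sides solve C′ = -(p + q) S, S′ = (p + q) C with the same initial values. The two claims are
-- proved together because the derivative of each is expressed by the other.
addTerm : ∀ p q l →
  cosTerm (p ℚ.+ q) l ≡
    conv (cosTerm p) (cosTerm q) l ℚ.- conv (sinTerm p) (sinTerm q) l ×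
  sinTerm (p ℚ.+ q) l ≡
    conv (sinTerm p) (cosTerm q) l ℚ.+ conv (cosTerm p) (sinTerm q) l
addTerm p q zero    = refl , refl
addTerm p q (suc l) =
  let (hc , hs) = addTerm p q l
      n = ℕ→ℚ (suc l)
      cc = conv (cosTerm p) (cosTerm q)
      ss = conv (sinTerm p) (sinTerm q)
      sc = conv (sinTerm p) (cosTerm q)
      cs = conv (cosTerm p) (sinTerm q)
      dcp = cosTerm-deriv p
      dcq = cosTerm-deriv q
      dsp = sinTerm-deriv p
      dsq = sinTerm-deriv q
  in sym (suc*-cancel l (trans
       (solve 3 (λ n x y → n :* (x :- y) := n :* x :- n :* y) refl n (cc (suc l)) (ss (suc l)))
       (trans (cong₂ ℚ._-_ (deriv-conv (ℚ.- p) (ℚ.- q) dcp dcq l) (deriv-conv p q dsp dsq l))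
       (trans (solve 4 (λ p q sc cs → ((:- p) :* sc :+ (:- q) :* cs) :- (p :* cs :+ q :* sc)
                  := (:- (p :+ q)) :* (sc :+ cs)) refl p q (sc l) (cs l))
         (cong (ℚ.- (p ℚ.+ q) ℚ.*_) (sym hs))))))
   , sym (suc*-cancel l (trans
       (ℚP.*-distribˡ-+ n (sc (suc l)) (cs (suc l)))
       (trans (cong₂ ℚ._+_ (deriv-conv p (ℚ.- q) dsp dcq l) (deriv-conv (ℚ.- p) q dcp dsq l))
       (trans (solve 4 (λ p q cc ss → (p :* cc :+ (:- q) :* ss) :+ ((:- p) :* ss :+ q :* cc)
                  := (p :+ q) :* (cc :- ss)) refl p q (cc l) (ss l))
         (cong ((p ℚ.+ q) ℚ.*_) (sym hc))))))

partial-+ : ∀ a b n → partial (λ j → a j ℚ.+ b j) n ≡ partial a n ℚ.+ partial b n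
partial-+ a b zero    = refl
partial-+ a b (suc n) = trans (cong (ℚ._+ (a n ℚ.+ b n)) (partial-+ a b n))
  (solve 4 (λ x y a b → (x :+ y) :+ (a :+ b) := (x :+ a) :+ (y :+ b)) refl
    (partial a n) (partial b n) (a n) (b n))

partial-- : ∀ a b n → partial (λ j → a j ℚ.- b j) n ≡ partial a n ℚ.- partial b n
partial-- a b zero    = refl
partial-- a b (suc n) = trans (cong (ℚ._+ (a n ℚ.- b n)) (partial-- a b n))
  (solve 4 (λ x y a b → (x :- y) :+ (a :- b) := (x :+ a) :- (y :+ b)) refl
    (partial a n) (partial b n) (a n) (b n))

-- The error is expanded around `x` and `y`, whose boundedness follows from being Cauchy, instead of
-- around `f` and `g`; what remains is a product of two null sequences.
null-product : ∀ x y (f g : ℕ → ℚ) → Null (λ n → seq x n ℚ.- f n) → Null (λ n → seq y n ℚ.- g n) →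
  Null (λ n → seq x n ℚ.* seq y n ℚ.- f n ℚ.* g n)
null-product x y f g hf hg = null-ext
  (null-- (null-+ (null-*ˡ x hg) (null-*ˡ y hf)) (null-** {λ n → seq x n ℚ.- f n} {λ n → seq y n ℚ.- g n} hf hg))
  (λ n → solve 4 (λ x y f g → (x :* (y :- g) :+ y :* (x :- f)) :- (x :- f) :* (y :- g)
      := x :* y :- f :* g) refl (seq x n) (seq y n) (f n) (g n))

module _ (x y : ℝ) where

  private
    Bx = proj₁ (eventually-bounded x)
    Kx = proj₁ (proj₂ (eventually-bounded x))
    By = proj₁ (eventually-bounded y)
    Ky = proj₁ (proj₂ (eventually-bounded y))
    -- One bound for both arguments, so that the two series share the majorant in
    -- `square-conv-close`.
    A = suc Bx ℕ.+ suc By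

    ≤A₁ : ∀ k → Kx ℕ.≤ k → ℚ.∣ seq x k ∣ ℚ.≤ ℕ→ℚ A
    ≤A₁ k p = ℚP.≤-trans (proj₂ (proj₂ (eventually-bounded x)) k p)
                          (ℕ→ℚ-mono (ℕP.m≤m+n (suc Bx) (suc By)))

    ≤A₂ : ∀ k → Ky ℕ.≤ k → ℚ.∣ seq y k ∣ ℚ.≤ ℕ→ℚ A
    ≤A₂ k p = ℚP.≤-trans (proj₂ (proj₂ (eventually-bounded y)) k p)
                          (ℕ→ℚ-mono (ℕP.m≤n+m (suc By) (suc Bx)))

    null-conv : (X Y : ℝ) (a b : ℚ → ℕ → ℚ) →
      (∀ {q} → ℚ.∣ q ∣ ℚ.≤ ℕ→ℚ A → ∀ j → ℚ.∣ a q j ∣ ℚ.≤ majorant A j) →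
      (∀ {q} → ℚ.∣ q ∣ ℚ.≤ ℕ→ℚ A → ∀ j → ℚ.∣ b q j ∣ ℚ.≤ majorant A j) →
      Null (λ n → seq X n ℚ.- partial (a (seq x n)) n) →
      Null (λ n → seq Y n ℚ.- partial (b (seq y n)) n) →
      Null (λ n → seq X n ℚ.* seq Y n ℚ.- partial (conv (a (seq x n)) (b (seq y n))) n)
    null-conv X Y a b ha hb hX hY = null-ext
      (null-+
        (null-product X Y (λ n → partial (a (seq x n)) n) (λ n → partial (b (seq y n)) n) hX hY)
        close)
      (λ n → solve 3 (λ p q r → (p :- q) :+ (q :- r) := p :- r) refl
        (seq X n ℚ.* seq Y n) (partial (a (seq x n)) n ℚ.* partial (b (seq y n)) n)
        (partial (conv (a (seq x n)) (b (seq y n))) n))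
      where
      close : Null (λ n → partial (a (seq x n)) n ℚ.* partial (b (seq y n)) n ℚ.-
                          partial (conv (a (seq x n)) (b (seq y n))) n)
      close ε 0<ε =
        let (N , small) = tail-small (A ℕ.+ A) ε 0<ε
        in N ℕ.⊔ (Kx ℕ.⊔ Ky) , λ n p →
          let q = ℕP.m⊔n≤o⇒n≤o N (Kx ℕ.⊔ Ky) p in
          ℚP.≤-trans
            (square-conv-close A (ha (≤A₁ n (ℕP.m⊔n≤o⇒m≤o Kx Ky q)))
                                 (hb (≤A₂ n (ℕP.m⊔n≤o⇒n≤o Kx Ky q))) n)
            (small n n (ℕP.m⊔n≤o⇒m≤o N _ p))

  cos-+ : cos (x + y) ≈ cos x * cos y - sin x * sin y
  cos-+ = null-ext
    (null-+ (null-- (cos-diagonal (x + y))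
        (null-conv (cos x) (cos y) cosTerm cosTerm (cosTerm-bound A) (cosTerm-bound A)
          (cos-diagonal x) (cos-diagonal y)))
        (null-conv (sin x) (sin y) sinTerm sinTerm (sinTerm-bound A) (sinTerm-bound A)
          (sin-diagonal x) (sin-diagonal y)))
    (λ n → trans
      (cong (λ t → ((seq (cos (x + y)) n ℚ.- t) ℚ.- (seq (cos x) n ℚ.* seq (cos y) n ℚ.- cc n))
                     ℚ.+ (seq (sin x) n ℚ.* seq (sin y) n ℚ.- ss n))
        (trans (partial-cong (λ l → proj₁ (addTerm (seq x n) (seq y n) l)) n)
          (partial-- (conv (cosTerm (seq x n)) (cosTerm (seq y n)))
                     (conv (sinTerm (seq x n)) (sinTerm (seq y n))) n)))
      (solve 5 (λ C p q c s → ((C :- (c :- s)) :- (p :- c)) :+ (q :- s) := C :- (p :- q)) refl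
        (seq (cos (x + y)) n) (seq (cos x) n ℚ.* seq (cos y) n)
        (seq (sin x) n ℚ.* seq (sin y) n) (cc n) (ss n)))
    where
    cc ss : ℕ → ℚ
    cc n = partial (conv (cosTerm (seq x n)) (cosTerm (seq y n))) n
    ss n = partial (conv (sinTerm (seq x n)) (sinTerm (seq y n))) n

  sin-+ : sin (x + y) ≈ sin x * cos y + cos x * sin y
  sin-+ = null-ext
    (null-- (null-- (sin-diagonal (x + y))
        (null-conv (sin x) (cos y) sinTerm cosTerm (sinTerm-bound A) (cosTerm-bound A)
          (sin-diagonal x) (cos-diagonal y)))
        (null-conv (cos x) (sin y) cosTerm sinTerm (cosTerm-bound A) (sinTerm-bound A)
          (cos-diagonal x) (sin-diagonal y)))
    (λ n → trans
      (cong (λ t → ((seq (sin (x + y)) n ℚ.- t) ℚ.- (seq (sin x) n ℚ.* seq (cos y) n ℚ.- sc n))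
                     ℚ.- (seq (cos x) n ℚ.* seq (sin y) n ℚ.- cs n))
        (trans (partial-cong (λ l → proj₂ (addTerm (seq x n) (seq y n) l)) n)
          (partial-+ (conv (sinTerm (seq x n)) (cosTerm (seq y n)))
                     (conv (cosTerm (seq x n)) (sinTerm (seq y n))) n)))
      (solve 5 (λ C p q c s → ((C :- (c :+ s)) :- (p :- c)) :- (q :- s) := C :- (p :+ q)) refl
        (seq (sin (x + y)) n) (seq (sin x) n ℚ.* seq (cos y) n)
        (seq (cos x) n ℚ.* seq (sin y) n) (sc n) (cs n)))
    where
    sc cs : ℕ → ℚ
    sc n = partial (conv (sinTerm (seq x n)) (cosTerm (seq y n))) n
    cs n = partial (conv (cosTerm (seq x n)) (sinTerm (seq y n))) n

-- Parity, the Pythagorean identity and double angles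

negTerm : ∀ q j → cosTerm (ℚ.- q) j ≡ cosTerm q j × sinTerm (ℚ.- q) j ≡ ℚ.- sinTerm q j
negTerm q zero    = refl , refl
negTerm q (suc j) = let (hc , hs) = negTerm q j in
    trans (cong (λ t → recip j ℚ.* (ℚ.- (ℚ.- q) ℚ.* t)) hs)
      (solve 3 (λ r q s → r :* ((:- (:- q)) :* (:- s)) := r :* ((:- q) :* s)) refl
        (recip j) q (sinTerm q j))
  , trans (cong (λ t → recip j ℚ.* (ℚ.- q ℚ.* t)) hc)
      (solve 3 (λ r q c → r :* ((:- q) :* c) := :- (r :* (q :* c))) refl
        (recip j) q (cosTerm q j))

partial-neg : ∀ a n → partial (λ j → ℚ.- a j) n ≡ ℚ.- partial a n
partial-neg a zero    = refl
partial-neg a (suc n) = trans (cong (ℚ._+ (ℚ.- a n)) (partial-neg a n))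
  (sym (ℚP.neg-distrib-+ (partial a n) (a n)))

cos-neg : ∀ x → cos (- x) ≈ cos x
cos-neg x = null-ext
  (null-- (cos-diagonal (- x)) (cos-diagonal x))
  (λ n → trans (cong (λ t → (seq (cos (- x)) n ℚ.- t) ℚ.-
                   (seq (cos x) n ℚ.- partial (cosTerm (seq x n)) n))
      (partial-cong (λ j → proj₁ (negTerm (seq x n) j)) n))
    (solve 3 (λ a b c → (a :- c) :- (b :- c) := a :- b) refl
      (seq (cos (- x)) n) (seq (cos x) n) (partial (cosTerm (seq x n)) n)))

sin-neg : ∀ x → sin (- x) ≈ - sin x
sin-neg x = null-ext
  (null-+ (sin-diagonal (- x)) (sin-diagonal x))
  (λ n → trans (cong (λ t → (seq (sin (- x)) n ℚ.- t) ℚ.+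
                   (seq (sin x) n ℚ.- partial (sinTerm (seq x n)) n))
      (trans (partial-cong (λ j → proj₂ (negTerm (seq x n) j)) n)
        (partial-neg (sinTerm (seq x n)) n)))
    (solve 3 (λ a b c → (a :- (:- c)) :+ (b :- c) := a :- (:- b)) refl
      (seq (sin (- x)) n) (seq (sin x) n) (partial (sinTerm (seq x n)) n)))

cos-zero : cos (ι 0ℚ) ≈ ι 1ℚ
cos-zero = null-ext
  -- The threshold is 1 because the empty partial sum is 0, while all later ones are 1.
  (null-+ (cos-diagonal (ι 0ℚ)) λ ε 0<ε → 1 , λ where
    (suc n) _ → subst (λ t → ℚ.∣ t ∣ ℚ.≤ ε)
      (sym (trans (cong (ℚ._- 1ℚ) (trans (partial-cons (cosTerm 0ℚ) n) (cong (1ℚ ℚ.+_) (vanish n))))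
        refl)) (ℚP.<⇒≤ 0<ε))
  (λ n → solve 2 (λ a b → (a :- b) :+ (b :- con 1ℚ) := a :- con 1ℚ) refl
    (seq (cos (ι 0ℚ)) n) (partial (cosTerm 0ℚ) n))
  where
  vanish : ∀ n → partial (cosTerm 0ℚ ∘ suc) n ≡ 0ℚ
  vanish zero    = refl
  vanish (suc n) = cong₂ ℚ._+_ (vanish n)
    (solve 2 (λ r s → r :* (con 0ℚ :* s) := con 0ℚ) refl (recip n) (sinTerm 0ℚ n))

-- Compares cos (x + (- x)), expanded by `cos-+` and parity, with cos 0 = 1.
cos²+sin² : ∀ x → cos x * cos x + sin x * sin x ≈ ι 1ℚ
cos²+sin² x = null-ext
  (null-+ (null-- (null-- (null-+ cos-zero
      (cos-cong {x - x} {ι 0ℚ} (λ n → ℚP.+-inverseʳ (seq x n))))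
    (cos-+ x (- x))) (null-*ˡ (cos x) (cos-neg x))) (null-*ˡ (sin x) (sin-neg x)))
  (λ n → solve 6 (λ c s c′ s′ d e →
      ((e :- con 1ℚ) :+ (d :- e)) :- (d :- (c :* c′ :- s :* s′)) :- c :* (c′ :- c)
        :+ s :* (s′ :- (:- s)) := (c :* c :+ s :* s) :- con 1ℚ) refl
    (seq (cos x) n) (seq (sin x) n) (seq (cos (- x)) n) (seq (sin (- x)) n)
    (seq (cos (x - x)) n) (seq (cos (ι 0ℚ)) n))

module _ (x y : ℝ) (y+y≡x : ∀ n → seq y n ℚ.+ seq y n ≡ seq x n) where

  sin-double : sin x ≈ sin y * cos y + cos y * sin y
  sin-double = null-ext
    (null-- (sin-+ y y) (sin-cong {y + y} {x} y+y≡x))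
    (λ n → solve 3 (λ a b c → (b :- c) :- (b :- a) := a :- c) refl
      (seq (sin x) n) (seq (sin (y + y)) n) (seq (sin y * cos y + cos y * sin y) n))

  cos-double : cos x ≈ cos y * cos y - sin y * sin y
  cos-double = null-ext
    (null-- (cos-+ y y) (cos-cong {y + y} {x} y+y≡x))
    (λ n → solve 3 (λ a b c → (b :- c) :- (b :- a) := a :- c) refl
      (seq (cos x) n) (seq (cos (y + y)) n) (seq (cos y * cos y - sin y * sin y) n))

-- The inequality sin² x ≤ x²

private
  2ℚ 4ℚ : ℚ
  2ℚ = ℕ→ℚ 2
  4ℚ = ℕ→ℚ 4

½p+½p≡p : ∀ p → ½ ℚ.* p ℚ.+ ½ ℚ.* p ≡ p
½p+½p≡p = solve 1 (λ p → con ½ :* p :+ con ½ :* p := p) refl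

halved : ℕ → ℝ → ℝ
halved zero    x = x
halved (suc n) x = ι ½ * halved n x

4^ : ℕ → ℚ
4^ zero    = 1ℚ
4^ (suc n) = 4ℚ ℚ.* 4^ n

4^-nonneg : ∀ n → 0ℚ ℚ.≤ 4^ n
4^-nonneg zero    = ℕ→ℚ-nonneg 1
4^-nonneg (suc n) = *-nonneg (ℕ→ℚ-nonneg 4) (4^-nonneg n)

-- sin² 2y = 4 sin² y cos² y ≤ 4 sin² y
sin²-double : ∀ x y → (∀ n → seq y n ℚ.+ seq y n ≡ seq x n) →
  sin x * sin x ≤ ι 4ℚ * (sin y * sin y)
sin²-double x y y+y≡x = nonneg⇒≤ (sin x * sin x) (ι 4ℚ * (sin y * sin y)) (nonneg-ext
  (nonneg-+ (pointwise⇒nonneg (λ n → 0≤p*p (2ℚ ℚ.* (seq (sin y) n ℚ.* seq (sin y) n))))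
    (null⇒nonneg (null-neg (null-+
      (null-*ˡ (ι 4ℚ * (sin y * sin y)) (cos²+sin² y))
      (null-*ˡ (sin x + ι 2ℚ * (sin y * cos y)) (sin-double x y y+y≡x))))))
  (λ n → solve 3 (λ S s c → (con 2ℚ :* (s :* s)) :* (con 2ℚ :* (s :* s))
        :+ (:- (con 4ℚ :* (s :* s) :* ((c :* c :+ s :* s) :- con 1ℚ)
              :+ (S :+ con 2ℚ :* (s :* c)) :* (S :- (s :* c :+ c :* s))))
      := con 4ℚ :* (s :* s) :- S :* S) refl (seq (sin x) n) (seq (sin y) n) (seq (cos y) n)))

sin²-halved : ∀ n x → sin x * sin x ≤ ι (4^ n) * (sin (halved n x) * sin (halved n x))
sin²-halved zero x = nonneg⇒≤ (sin x * sin x) (ι 1ℚ * (sin x * sin x))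
  (null⇒nonneg (≡⇒null (λ k →
    solve 1 (λ s → con 1ℚ :* (s :* s) :- s :* s := con 0ℚ) refl (seq (sin x) k))))
sin²-halved (suc n) x = nonneg⇒≤ (sin x * sin x) (ι (4^ (suc n)) * (sin z * sin z))
  (nonneg-ext
    (nonneg-+
      (nonneg-*ˡ (ι (4^ n)) (λ _ → 4^-nonneg n)
        (≤⇒nonneg (sin y * sin y) (ι 4ℚ * (sin z * sin z))
          (sin²-double y z (λ k → ½p+½p≡p (seq y k)))))
      (≤⇒nonneg (sin x * sin x) (ι (4^ n) * (sin y * sin y)) (sin²-halved n x)))
    (λ k → identity (4^ n) (seq (sin z) k) (seq (sin y) k) (seq (sin x) k)))
  where
  y = halved n x
  z = halved (suc n) x
  identity : ∀ q s S T → q ℚ.* (4ℚ ℚ.* (s ℚ.* s) ℚ.- S ℚ.* S) ℚ.+ (q ℚ.* (S ℚ.* S) ℚ.- T ℚ.* T) ≡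
    4ℚ ℚ.* q ℚ.* (s ℚ.* s) ℚ.- T ℚ.* T
  identity = solve 4 (λ q s S T → q :* (con 4ℚ :* (s :* s) :- S :* S) :+ (q :* (S :* S) :- T :* T)
      := con 4ℚ :* q :* (s :* s) :- T :* T) refl

halved² : ∀ n x k → 4^ n ℚ.* (seq (halved n x) k ℚ.* seq (halved n x) k) ≡ seq x k ℚ.* seq x k
halved² zero    x k = ℚP.*-identityˡ _
halved² (suc n) x k = trans
  (solve 2 (λ q y → con 4ℚ :* q :* ((con ½ :* y) :* (con ½ :* y)) := q :* (y :* y)) refl
    (4^ n) (seq (halved n x) k))
  (halved² n x k)

-- Since n + 2 ≤ 2 (n + 1), halving gains at least this much. The linear rate is chosen to fit
-- `archimedean`, which speaks about `recip n`.
halved-bound : ∀ n x k → ℕ→ℚ (suc n) ℚ.* ℚ.∣ seq (halved n x) k ∣ ℚ.≤ ℚ.∣ seq x k ∣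
halved-bound zero    x k = ℚP.≤-reflexive (ℚP.*-identityˡ _)
halved-bound (suc n) x k = ℚP.≤-trans
  (subst₂ ℚ._≤_
    (cong (ℕ→ℚ (suc (suc n)) ℚ.*_) (sym (ℚP.∣p*q∣≡∣p∣*∣q∣ ½ (seq (halved n x) k))))
    (trans (cong (ℚ._* (½ ℚ.* a)) (ℤ→ℚ-+ (+ suc n) (+ suc n)))
      (solve 2 (λ m a → (m :+ m) :* (con ½ :* a) := m :* a) refl (ℕ→ℚ (suc n)) a))
    (ℚP.*-monoʳ-≤-nonNeg (½ ℚ.* a)
      {{ℚ.nonNegative (*-nonneg (ℚP.nonNegative⁻¹ ½) (ℚP.0≤∣p∣ (seq (halved n x) k)))}}
      (ℕ→ℚ-mono (ℕ.s≤s (subst (suc n ℕ.≤_) (sym (ℕP.+-suc n n)) (ℕ.s≤s (ℕP.m≤m+n n n)))))))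
  (halved-bound n x k)
  where a = ℚ.∣ seq (halved n x) k ∣

½^ : ℕ → ℚ
½^ zero    = 1ℚ
½^ (suc n) = ½ ℚ.* ½^ n

½^-nonneg : ∀ n → 0ℚ ℚ.≤ ½^ n
½^-nonneg zero    = ℕ→ℚ-nonneg 1
½^-nonneg (suc n) = *-nonneg (ℚP.nonNegative⁻¹ ½) (½^-nonneg n)

module _ {q : ℚ} (q≤1 : ℚ.∣ q ∣ ℚ.≤ 1ℚ) where

  private
    step : ∀ j {p t u} → ℚ.∣ p ∣ ≡ ℚ.∣ q ∣ → ℚ.∣ t ∣ ℚ.≤ u →
      ℚ.∣ recip (suc j) ℚ.* (p ℚ.* t) ∣ ℚ.≤ ½ ℚ.* u
    step j {p} {t} {u} p≡q t≤u = ∣p*q∣≤ {recip (suc j)} {p ℚ.* t}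
      (subst (ℚ._≤ ½) (sym (ℚP.0≤p⇒∣p∣≡p (ℚP.<⇒≤ (recip-pos (suc j)))))
        -- On ½ the threshold of `archimedean` computes to 1, the stored denominator minus one.
        (proj₂ (archimedean ½ (ℚP.positive⁻¹ ½)) (suc j) (ℕ.s≤s ℕ.z≤n)))
      (subst (ℚ.∣ p ℚ.* t ∣ ℚ.≤_) (ℚP.*-identityˡ u)
        (∣p*q∣≤ {p} {t} (subst (ℚ._≤ 1ℚ) (sym p≡q) q≤1) t≤u))

  -- From the quadratic term on, each step multiplies by |q| ≤ 1 and by a reciprocal of at most ½.
  -- Keeping the factor q² in front makes the error of sin q ≈ q quadratic.
  term-decay : ∀ j →
    ℚ.∣ cosTerm q (suc (suc j)) ∣ ℚ.≤ q ℚ.* q ℚ.* ½^ (suc j) ×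
    ℚ.∣ sinTerm q (suc (suc j)) ∣ ℚ.≤ q ℚ.* q ℚ.* ½^ (suc j)
  term-decay zero =
      ℚP.≤-reflexive (trans
        (cong ℚ.∣_∣ (solve 1 (λ q → con ½ :* ((:- q) :* (con 1ℚ :* (q :* con 1ℚ)))
            := :- (q :* q :* con ½)) refl q))
        (trans (ℚP.∣-p∣≡∣p∣ (q ℚ.* q ℚ.* ½)) (ℚP.0≤p⇒∣p∣≡p 0≤)))
    , subst (ℚ._≤ q ℚ.* q ℚ.* ½)
        (cong ℚ.∣_∣ (solve 1 (λ q → con 0ℚ
            := con ½ :* (q :* (con 1ℚ :* ((:- q) :* con 0ℚ)))) refl q)) 0≤
    where
    0≤ = *-nonneg (0≤p*p q) (ℚP.nonNegative⁻¹ ½)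
  term-decay (suc j) = let (hc , hs) = term-decay j in
      subst (ℚ.∣ cosTerm q (suc (suc (suc j))) ∣ ℚ.≤_) (rearrange (½^ (suc j)))
        (step (suc j) {ℚ.- q} {sinTerm q (suc (suc j))} (ℚP.∣-p∣≡∣p∣ q) hs)
    , subst (ℚ.∣ sinTerm q (suc (suc (suc j))) ∣ ℚ.≤_) (rearrange (½^ (suc j)))
        (step (suc j) {q} {cosTerm q (suc (suc j))} refl hc)
    where
    rearrange : ∀ h → ½ ℚ.* (q ℚ.* q ℚ.* h) ≡ q ℚ.* q ℚ.* (½ ℚ.* h)
    rearrange = solve 2 (λ q h → con ½ :* (q :* q :* h) := q :* q :* (con ½ :* h)) refl q

  sin-series-close : ∀ n → ℚ.∣ partial (sinTerm q) (suc (suc n)) ℚ.- q ∣ ℚ.≤ q ℚ.* q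
  sin-series-close n = ℚP.≤-trans (go n)
    (subst (q ℚ.* q ℚ.* (1ℚ ℚ.- ½^ n) ℚ.≤_) (ℚP.*-identityʳ (q ℚ.* q))
      (ℚP.*-monoˡ-≤-nonNeg (q ℚ.* q) {{ℚ.nonNegative (0≤p*p q)}}
        (diff-0≤ (subst (0ℚ ℚ.≤_)
          (solve 1 (λ h → h := con 1ℚ :- (con 1ℚ :- h)) refl (½^ n)) (½^-nonneg n)))))
    where
    go : ∀ n → ℚ.∣ partial (sinTerm q) (suc (suc n)) ℚ.- q ∣ ℚ.≤ q ℚ.* q ℚ.* (1ℚ ℚ.- ½^ n)
    go zero = ℚP.≤-reflexive (trans
      (cong ℚ.∣_∣ (solve 1 (λ q → con 0ℚ :+ con 0ℚ :+ con 1ℚ :* (q :* con 1ℚ) :- q := con 0ℚ) refl q))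
      (solve 1 (λ q → con 0ℚ := q :* q :* con 0ℚ) refl q))
    go (suc n) = subst₂ ℚ._≤_
      (cong ℚ.∣_∣ (solve 3 (λ p q t → (p :- q) :+ t := (p :+ t) :- q) refl
        (partial (sinTerm q) (suc (suc n))) q (sinTerm q (suc (suc n)))))
      (solve 2 (λ q h → q :* q :* (con 1ℚ :- h) :+ q :* q :* (con ½ :* h)
          := q :* q :* (con 1ℚ :- con ½ :* h)) refl q (½^ n))
      (∣p+q∣≤ {partial (sinTerm q) (suc (suc n)) ℚ.- q} (go n) (proj₂ (term-decay n)))

  -- With t = |q| ≤ 1, `sin-series-close` gives |p| ≤ t + t², and (t + t²)² = t² (1 + 2t + t²) ≤ t²
  -- (1 + 3t). The error is relative to q² so that it survives the factor 4ⁿ in `sin²≤²`, where 4ⁿ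
  -- y² = x².
  sin-series² : ∀ {δ} → ℚ.∣ q ∣ ℚ.≤ δ → ∀ n → let p = partial (sinTerm q) (suc (suc n)) in
    p ℚ.* p ℚ.≤ q ℚ.* q ℚ.* (1ℚ ℚ.+ (δ ℚ.+ δ ℚ.+ δ))
  sin-series² {δ} q≤δ n = subst₂ ℚ._≤_
    (sym (p*p≡∣p∣*∣p∣ p))
    (cong (ℚ._* (1ℚ ℚ.+ (δ ℚ.+ δ ℚ.+ δ))) (sym (p*p≡∣p∣*∣p∣ q)))
    (ℚP.≤-trans (*-mono-≤-nonneg (ℚP.≤-trans (ℚP.0≤∣p∣ p) ∣p∣≤) (ℚP.0≤∣p∣ p) ∣p∣≤ ∣p∣≤)
      (subst (ℚ._≤ t ℚ.* t ℚ.* (1ℚ ℚ.+ (δ ℚ.+ δ ℚ.+ δ)))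
        (solve 1 (λ t → t :* t :* (con 1ℚ :+ (t :+ t :+ con 1ℚ :* t) :+ (t :* t :- t))
            := (t :* t :+ t) :* (t :* t :+ t)) refl t)
        (ℚP.*-monoˡ-≤-nonNeg (t ℚ.* t) {{ℚ.nonNegative (0≤p*p t)}}
          (subst (_ ℚ.≤_) (ℚP.+-identityʳ _)
            (ℚP.+-mono-≤
              (ℚP.+-monoʳ-≤ 1ℚ (ℚP.+-mono-≤ (ℚP.+-mono-≤ q≤δ q≤δ)
                (subst (ℚ._≤ δ) (sym (ℚP.*-identityˡ t)) q≤δ)))
              (subst (t ℚ.* t ℚ.- t ℚ.≤_) (ℚP.+-inverseʳ t) (ℚP.+-monoˡ-≤ (ℚ.- t)
                (subst (t ℚ.* t ℚ.≤_) (ℚP.*-identityˡ t)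
                  (ℚP.*-monoʳ-≤-nonNeg t {{ℚ.nonNegative (ℚP.0≤∣p∣ q)}} q≤1)))))))))
    where
    p = partial (sinTerm q) (suc (suc n))
    t = ℚ.∣ q ∣
    ∣p∣≤ : ℚ.∣ p ∣ ℚ.≤ t ℚ.* t ℚ.+ t
    ∣p∣≤ = ℚP.≤-trans (∣p∣≤∣p-q∣+∣q∣ p q)
      (ℚP.+-monoˡ-≤ t (subst (ℚ.∣ p ℚ.- q ∣ ℚ.≤_) (p*p≡∣p∣*∣p∣ q) (sin-series-close n)))

-- For y = x / 2ⁿ one has sin² x ≤ 4ⁿ sin² y, and up to a null sequence this is at most 4ⁿ y² (1 +
-- 3δ) = x² + 3δ x². A suitable n makes the last term smaller than any given ε.
sin²≤² : ∀ x → sin x * sin x ≤ x * x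
sin²≤² x = nonneg⇒≤ (sin x * sin x) (x * x) (nonneg-closed almost)
  where
  B = proj₁ (eventually-bounded x)
  K = proj₁ (proj₂ (eventually-bounded x))
  b = proj₂ (proj₂ (eventually-bounded x))
  C = ℕ→ℚ (suc B)
  0≤C = ℕ→ℚ-nonneg (suc B)
  0<r = recip-pos B
  X : ℕ → ℚ
  X k = seq x k ℚ.* seq x k
  almost : ∀ ε → 0ℚ ℚ.< ε → NonNeg (λ k → X k ℚ.- seq (sin x) k ℚ.* seq (sin x) k ℚ.+ ε)
  almost ε 0<ε = nonneg-ext
    (nonneg-+ (nonneg-+ (eventually⇒nonneg (K ℕ.⊔ 2 , main))
        (≤⇒nonneg (sin x * sin x) (ι (4^ n) * (sin y * sin y)) (sin²-halved n x)))
      (null⇒nonneg (null-neg (null-*ˡ (ι (4^ n))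
        (null-product (sin y) (sin y) P P (sin-diagonal y) (sin-diagonal y))))))
    (λ k → solve 6 (λ X e q P s S →
        ((X :+ e :- q :* (P :* P)) :+ (q :* (s :* s) :- S :* S)) :+ (:- (q :* (s :* s :- P :* P)))
          := (X :- S :* S) :+ e) refl (X k) ε (4^ n) (P k) (seq (sin y) k) (seq (sin x) k))
    where
    -- This is ε / (3C³): as δ = C / (n + 1) and x² ≤ C², the excess is at most 3C³ / (n + 1). The
    -- other threshold, `arch₁`, secures δ ≤ 1.
    η = ε ℚ.* (recip B ℚ.* recip B ℚ.* recip B ℚ.* recip 2)
    0<η = *-pos 0<ε (*-pos (*-pos (*-pos 0<r 0<r) 0<r) (recip-pos 2))
    arch₁ = archimedean (recip B) 0<r
    arch₂ = archimedean η 0<η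
    n = proj₁ arch₁ ℕ.⊔ proj₁ arch₂
    y = halved n x
    δ = recip n ℚ.* C
    3δ = δ ℚ.+ δ ℚ.+ δ
    0≤δ = *-nonneg (ℚP.<⇒≤ (recip-pos n)) 0≤C
    0≤3δ = ℚP.+-mono-≤ (ℚP.+-mono-≤ 0≤δ 0≤δ) 0≤δ
    P : ℕ → ℚ
    P k = partial (sinTerm (seq y k)) k
    δ≤1 : δ ℚ.≤ 1ℚ
    δ≤1 = subst (δ ℚ.≤_) (trans (ℚP.*-comm (recip B) C) (suc*recip B))
      (ℚP.*-monoʳ-≤-nonNeg C {{ℚ.nonNegative 0≤C}}
        (proj₂ arch₁ n (ℕP.m≤m⊔n (proj₁ arch₁) (proj₁ arch₂))))
    C²3δ≤ε : (C ℚ.* C) ℚ.* 3δ ℚ.≤ ε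
    C²3δ≤ε = subst₂ ℚ._≤_
      (solve 2 (λ r C → r :* (C :* C :* C :* con (ℕ→ℚ 3)) :=
         (C :* C) :* (r :* C :+ r :* C :+ r :* C)) refl (recip n) C)
      (trans (solve 3 (λ e r C → e :* (r :* r :* r :* con (recip 2)) :* (C :* C :* C :* con (ℕ→ℚ 3))
         := e :* ((C :* r) :* (C :* r) :* (C :* r))) refl ε (recip B) C)
        (trans (cong (λ t → ε ℚ.* (t ℚ.* t ℚ.* t)) (suc*recip B)) (ℚP.*-identityʳ ε)))
      (ℚP.*-monoʳ-≤-nonNeg (C ℚ.* C ℚ.* C ℚ.* ℕ→ℚ 3)
        {{ℚ.nonNegative (*-nonneg (*-nonneg (*-nonneg 0≤C 0≤C) 0≤C) (ℕ→ℚ-nonneg 3))}}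
        (proj₂ arch₂ n (ℕP.m≤n⊔m (proj₁ arch₁) (proj₁ arch₂))))
    small : ∀ k → K ℕ.≤ k → ℚ.∣ seq y k ∣ ℚ.≤ δ
    small k K≤k = subst (ℚ._≤ δ)
      (trans (solve 3 (λ r n a → r :* (n :* a) := (n :* r) :* a) refl
               (recip n) (ℕ→ℚ (suc n)) ℚ.∣ seq y k ∣)
        (trans (cong (ℚ._* ℚ.∣ seq y k ∣) (suc*recip n)) (ℚP.*-identityˡ _)))
      (ℚP.*-monoˡ-≤-nonNeg (recip n) {{ℚ.nonNegative (ℚP.<⇒≤ (recip-pos n))}}
        (ℚP.≤-trans (halved-bound n x k) (b k K≤k)))
    series : ∀ k → K ℕ.≤ k → 2 ℕ.≤ k →
      P k ℚ.* P k ℚ.≤ seq y k ℚ.* seq y k ℚ.* (1ℚ ℚ.+ 3δ)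
    series (suc (suc k)) K≤k _ = let s = small (suc (suc k)) K≤k in
      sin-series² (ℚP.≤-trans s δ≤1) s k
    series (suc zero) _ (ℕ.s≤s ())
    X≤C² : ∀ k → K ℕ.≤ k → X k ℚ.≤ C ℚ.* C
    X≤C² k K≤k = subst (ℚ._≤ C ℚ.* C) (sym (p*p≡∣p∣*∣p∣ (seq x k)))
      (*-mono-≤-nonneg 0≤C (ℚP.0≤∣p∣ (seq x k)) (b k K≤k) (b k K≤k))
    main : ∀ k → K ℕ.⊔ 2 ℕ.≤ k → 0ℚ ℚ.≤ X k ℚ.+ ε ℚ.- 4^ n ℚ.* (P k ℚ.* P k)
    main k p = 0≤-diff (ℚP.≤-trans
      (ℚP.*-monoˡ-≤-nonNeg (4^ n) {{ℚ.nonNegative (4^-nonneg n)}}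
        (series k (ℕP.m⊔n≤o⇒m≤o K 2 p) (ℕP.m⊔n≤o⇒n≤o K 2 p)))
      (subst (ℚ._≤ X k ℚ.+ ε)
        (trans (solve 2 (λ x d → x :+ x :* d := x :* (con 1ℚ :+ d)) refl (X k) 3δ)
          (trans (cong (ℚ._* (1ℚ ℚ.+ 3δ)) (sym (halved² n x k)))
            (ℚP.*-assoc (4^ n) (seq y k ℚ.* seq y k) (1ℚ ℚ.+ 3δ))))
        (ℚP.+-monoʳ-≤ (X k) (ℚP.≤-trans
          (ℚP.*-monoʳ-≤-nonNeg 3δ {{ℚ.nonNegative 0≤3δ}} (X≤C² k (ℕP.m⊔n≤o⇒m≤o K 2 p)))
          C²3δ≤ε))))

-- The inequality ∑ 8 / (2k+1)² ≤ π²

-- No excluded middle is needed: comparing the rational seq x N with ε / 2 is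
-- decidable.
not-apart⇒null : ∀ x →
  (∀ δ → 0ℚ ℚ.< δ → ¬ (∃ λ N → ∀ n → N ℕ.≤ n → δ ℚ.≤ ℚ.∣ seq x n ∣)) → Null (seq x)
not-apart⇒null x not-apart ε 0<ε with ℚ.∣ seq x N ∣ ℚP.≤? half ε
  where N = proj₁ (cauchy x (half (half ε)) (half-pos (half-pos 0<ε)))
... | yes small = N , λ n p → subst (ℚ.∣ seq x n ∣ ℚ.≤_) (half+half ε)
  (ℚP.≤-trans (∣p∣≤∣p-q∣+∣q∣ (seq x n) (seq x N))
    (ℚP.+-mono-≤ (ℚP.≤-trans (close n N p ℕP.≤-refl) half≤) small))
  where
  N = proj₁ (cauchy x (half (half ε)) (half-pos (half-pos 0<ε)))
  close = proj₂ (cauchy x (half (half ε)) (half-pos (half-pos 0<ε)))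
  half≤ : half (half ε) ℚ.≤ half ε
  half≤ = subst (half (half ε) ℚ.≤_) (half+half (half ε))
    (p≤p+q (ℚP.<⇒≤ (half-pos (half-pos 0<ε))))
... | no large = contradiction (N , far) (not-apart (half (half ε)) (half-pos (half-pos 0<ε)))
  where
  N = proj₁ (cauchy x (half (half ε)) (half-pos (half-pos 0<ε)))
  close = proj₂ (cauchy x (half (half ε)) (half-pos (half-pos 0<ε)))
  far : ∀ n → N ℕ.≤ n → half (half ε) ℚ.≤ ℚ.∣ seq x n ∣
  far n p = diff-0≤ (subst (0ℚ ℚ.≤_)
    (trans (cong (λ t → h ℚ.+ ℚ.∣ seq x n ∣ ℚ.- t) (sym (half+half (half ε))))
      (solve 2 (λ h x → h :+ x :- (h :+ h) := x :- h) refl h ℚ.∣ seq x n ∣))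
    (0≤-diff (ℚP.≤-trans (ℚP.<⇒≤ (ℚP.≰⇒> large))
      (ℚP.≤-trans (∣p∣≤∣p-q∣+∣q∣ (seq x N) (seq x n))
        (ℚP.+-monoˡ-≤ ℚ.∣ seq x n ∣ (close N n ℕP.≤-refl p))))))
    where h = half (half ε)

-- The binary tree obtained by replacing the angle x = (2k+1)h, where
-- 2Dh = π/2 and k < D, with x/2 and π/2 - x/2; the weights of the leaves
-- at depth e are added up.
fold : ℕ → ℕ → (ℕ → ℚ) → ℕ → ℚ
fold zero    D g k = g k
fold (suc e) D g k = fold e (D ℕ.+ D) g k ℚ.+ fold e (D ℕ.+ D) g ((D ℕ.+ D) ℕ.∸ suc k)

odd : ℕ → ℚ
odd k = ℕ→ℚ (suc (2 ℕ.* k))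

inv-odd² : ℕ → ℚ
inv-odd² k = recip (2 ℕ.* k) ℚ.* recip (2 ℕ.* k)

-- Reflecting the index is taking the complementary angle: `fold-bound` uses this to turn (2j+1) h′
-- into π/2 - (2k+1) h′.
odd-reflect : ∀ D k → k ℕ.< D → odd (D ℕ.∸ suc k) ≡ ℕ→ℚ (D ℕ.+ D) ℚ.- odd k
odd-reflect D k k<D = trans
  (solve 2 (λ a b → a := (a :+ b) :- b) refl (odd j) (odd k))
  (cong (ℚ._- odd k) (trans (sym (ℤ→ℚ-+ (+ suc (2 ℕ.* j)) (+ suc (2 ℕ.* k))))
    (cong ℕ→ℚ (trans lemma (cong₂ ℕ._+_ j+k+1≡D j+k+1≡D)))))
  where
  j = D ℕ.∸ suc k
  j+k+1≡D : j ℕ.+ suc k ≡ D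
  j+k+1≡D = ℕP.m∸n+n≡m k<D
  lemma : suc (2 ℕ.* j) ℕ.+ suc (2 ℕ.* k) ≡ (j ℕ.+ suc k) ℕ.+ (j ℕ.+ suc k)
  lemma = NS.solve 2 (λ j k → (NS.con 1 NS.:+ NS.con 2 NS.:* j) NS.:+ (NS.con 1 NS.:+ NS.con 2 NS.:* k)
    NS.:= (j NS.:+ (NS.con 1 NS.:+ k)) NS.:+ (j NS.:+ (NS.con 1 NS.:+ k))) refl j k
    where module NS = Data.Nat.Solver.+-*-Solver

-- This is 2ᵉ D, accumulated in the same way as the second argument of `fold`.
doubled : ℕ → ℕ → ℕ
doubled zero    D = D
doubled (suc e) D = doubled e (D ℕ.+ D)

+≤doubled : ∀ e D → 1 ℕ.≤ D → e ℕ.+ D ℕ.≤ doubled e D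
+≤doubled zero    D 1≤D = ℕP.≤-refl
+≤doubled (suc e) D 1≤D = ℕP.≤-trans
  (subst (ℕ._≤ e ℕ.+ (D ℕ.+ D)) (ℕP.+-suc e D) (ℕP.+-monoʳ-≤ e (ℕP.+-monoˡ-≤ D 1≤D)))
  (+≤doubled e (D ℕ.+ D) (ℕP.≤-trans 1≤D (ℕP.m≤m+n D D)))

-- The first m reflected indices are T - 1 down to n, exactly those missing from the second sum. The
-- induction hands them over one at a time.
partial-reflect : ∀ F m n T → m ℕ.+ n ≡ T →
  partial (λ k → F (T ℕ.∸ suc k)) m ℚ.+ partial F n ≡ partial F T
partial-reflect F zero    n T eq = trans (ℚP.+-identityˡ (partial F n)) (cong (partial F) eq)
partial-reflect F (suc m) n T eq = trans
  (trans (cong (λ i → P ℚ.+ F i ℚ.+ partial F n)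
      (trans (cong (ℕ._∸ suc m) (sym eq)) (ℕP.m+n∸m≡n m n)))
    (solve 3 (λ p f q → (p :+ f) :+ q := p :+ (q :+ f)) refl P (F n) (partial F n)))
  (partial-reflect F m (suc n) T (trans (ℕP.+-suc m n) eq))
  where P = partial (λ k → F (T ℕ.∸ suc k)) m

-- The children k and 2D - 1 - k of all k < D exhaust the indices below 2D without repetition, so
-- each index at the bottom level is a leaf of exactly one tree.
fold-sum : ∀ e D g → partial (fold e D g) D ≡ partial g (doubled e D)
fold-sum zero    D g = refl
fold-sum (suc e) D g = trans (partial-+ F (λ k → F ((D ℕ.+ D) ℕ.∸ suc k)) D)
  (trans (ℚP.+-comm (partial F D) (partial (λ k → F ((D ℕ.+ D) ℕ.∸ suc k)) D))
    (trans (partial-reflect F D D (D ℕ.+ D) refl) (fold-sum e (D ℕ.+ D) g)))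
  where F = fold e (D ℕ.+ D) g

inv-odd²-nonneg : ∀ k → 0ℚ ℚ.≤ inv-odd² k
inv-odd²-nonneg k = 0≤p*p (recip (2 ℕ.* k))

-- The tree with root index 0 has 2ⁿ ≥ n leaves at depth n, all of nonnegative weight.
partial≤fold : ∀ n → partial inv-odd² n ℚ.≤ fold n 1 inv-odd² 0
partial≤fold n = subst (partial inv-odd² n ℚ.≤_)
  (trans (sym (fold-sum n 1 inv-odd²)) (ℚP.+-identityˡ (fold n 1 inv-odd² 0)))
  (subst (λ m → partial inv-odd² n ℚ.≤ partial inv-odd² m) (ℕP.m∸n+n≡m n≤)
    (partial-≤ inv-odd²-nonneg (doubled n 1 ℕ.∸ n) n))
  where
  n≤ : n ℕ.≤ doubled n 1
  n≤ = ℕP.≤-trans (ℕP.m≤m+n n 1) (+≤doubled n 1 ℕP.≤-refl)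

-- The values at π/2 and the estimate along the tree

module _ (π : ℝ) (isPi : IsPi π) where

  private
    0<π = proj₁ isPi
    sinπ≈0 = proj₁ (proj₂ isPi)
    π-least = proj₂ (proj₂ isPi)

    ½π = ι ½ * π

    s = sin ½π
    c = cos ½π

    ½π+½π≡π : ∀ n → seq ½π n ℚ.+ seq ½π n ≡ seq π n
    ½π+½π≡π n = ½p+½p≡p (seq π n)

    0<½π : ι 0ℚ < ½π
    0<½π = let (δ , 0<δ , N , h) = 0<π in
      half δ , half-pos 0<δ , N , λ n p → subst₂ ℚ._≤_
        (solve 1 (λ d → con ½ :* (con 0ℚ :+ d) := con 0ℚ :+ d :* con ½) refl δ) refl
        (ℚP.*-monoˡ-≤-nonNeg ½ (h n p))

    π≰½π : ¬ (π ≤ ½π)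
    π≰½π π≤½π =
      let (δ , 0<δ , M , h) = 0<π
          -- With p the term of π at a late index, p ≤ p/2 + δ/4 gives p ≤ δ/2, against δ ≤ p.
          e = half (half δ)
          0<e = half-pos (half-pos 0<δ)
          (N , k) = π≤½π e 0<e
          n = M ℕ.⊔ N
          p = seq π n
          p≤½δ : p ℚ.≤ half δ
          p≤½δ = diff-0≤ (subst (0ℚ ℚ.≤_)
            (solve 2 (λ d p → (con ½ :* p :+ d :* con ½ :* con ½ :- p)
                :+ (con ½ :* p :+ d :* con ½ :* con ½ :- p) := d :* con ½ :- p) refl δ p)
            (ℚP.+-mono-≤ (0≤-diff (k n (ℕP.m≤n⊔m M N))) (0≤-diff (k n (ℕP.m≤n⊔m M N)))))
          δ≤½δ : δ ℚ.≤ half δ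
          δ≤½δ = ℚP.≤-trans (subst (ℚ._≤ p) (ℚP.+-identityˡ δ) (h n (ℕP.m≤m⊔n M N))) p≤½δ
          half<δ : half δ ℚ.< δ
          half<δ = subst₂ ℚ._<_ (ℚP.+-identityˡ (half δ)) (half+half δ)
            (ℚP.+-monoˡ-< (half δ) (half-pos 0<δ))
      in ℚP.<-irrefl refl (ℚP.≤-<-trans δ≤½δ half<δ)

    -- If cos (π/2) were apart from 0, then 0 = sin π = 2 sin (π/2) cos (π/2)
    -- would make π/2 a zero of sin, contradicting the minimality of π.
    cos-½π : Null (seq c)
    cos-½π = not-apart⇒null c λ δ 0<δ (M , far) → π≰½π (π-least ½π 0<½π (sin-½π≈0 δ 0<δ M far))
      where
      2sc : Null (λ n → seq s n ℚ.* seq c n ℚ.+ seq c n ℚ.* seq s n)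
      2sc = null-ext (null-- sinπ≈0 (sin-double π ½π ½π+½π≡π)) (λ n →
        solve 2 (λ a b → (a :- con 0ℚ) :- (a :- b) := b) refl
          (seq (sin π) n) (seq s n ℚ.* seq c n ℚ.+ seq c n ℚ.* seq s n))
      sin-½π≈0 : ∀ δ → 0ℚ ℚ.< δ → ∀ M → (∀ n → M ℕ.≤ n → δ ℚ.≤ ℚ.∣ seq c n ∣) → s ≈ ι 0ℚ
      sin-½π≈0 δ 0<δ M far ε 0<ε =
        let (N , h) = null-ext (null-*ˡ (ι ½) 2sc) (λ n →
              solve 2 (λ s c → con ½ :* (s :* c :+ c :* s) := c :* s) refl (seq s n) (seq c n))
              (δ ℚ.* ε) (*-pos 0<δ 0<ε)
        in M ℕ.⊔ N , λ n p → subst (λ t → ℚ.∣ t ∣ ℚ.≤ ε)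
             (solve 1 (λ s → s := s :- con 0ℚ) refl (seq s n))
             (ℚP.*-cancelˡ-≤-pos δ {{ℚ.positive 0<δ}} (ℚP.≤-trans
               (subst (δ ℚ.* ℚ.∣ seq s n ∣ ℚ.≤_) (sym (ℚP.∣p*q∣≡∣p∣*∣q∣ (seq c n) (seq s n)))
                 (ℚP.*-monoʳ-≤-nonNeg ℚ.∣ seq s n ∣ {{ℚ.nonNegative (ℚP.0≤∣p∣ (seq s n))}}
                   (far n (ℕP.m⊔n≤o⇒m≤o M N p))))
               (h n (ℕP.m⊔n≤o⇒n≤o M N p))))

    sin²-½π : Null (λ n → seq s n ℚ.* seq s n ℚ.- 1ℚ)
    sin²-½π = null-ext (null-- (cos²+sin² ½π) (null-*ˡ c cos-½π)) (λ n →
      solve 2 (λ s c → (c :* c :+ s :* s :- con 1ℚ) :- c :* c := s :* s :- con 1ℚ) refl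
        (seq s n) (seq c n))

    sin-complement : ∀ y z → (∀ n → seq z n ≡ seq ½π n ℚ.- seq y n) →
      sin z ≈ s * cos y
    sin-complement y z eq = null-ext
      (null-+ (null-+ (null-+ (sin-cong {z} {½π - y} eq) (sin-+ ½π (- y)))
        (null-*ˡ s (cos-neg y))) (null-*ˡ (sin (- y)) cos-½π))
      (λ n → solve 7 (λ z w s c y y′ u → (((z :- w) :+ (w :- (s :* y′ :+ c :* u))) :+ s :* (y′ :- y))
          :+ u :* c := z :- s :* y) refl
        (seq (sin z) n) (seq (sin (½π - y)) n) (seq s n) (seq c n) (seq (cos y) n)
        (seq (cos (- y)) n) (seq (sin (- y)) n))

  -- With c₁ = 2 cos (x/2) C and c₂ = 2 s sin (x/2) C, where s = sin (π/2) = ±1,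
  -- the identity c₁² + c₂² = 4 C² expresses that 1 / sin² x is a quarter of
  -- 1 / sin² (x/2) + 1 / sin² (π/2 - x/2).
  fold-bound : ∀ e D h k C → (∀ n → ℕ→ℚ (D ℕ.+ D) ℚ.* seq h n ≡ seq ½π n) → k ℕ.< D →
    C * sin (ι (odd k) * h) ≈ ι 1ℚ → ι (fold e D inv-odd² k) ≤ (h * h) * (C * C)
  -- At a leaf, r (2k+1) = 1 and x = (2k+1) h give h² C² - r² = r² C² (x² - sin² x) + r² (C² sin² x
  -- - 1), where the last summand is null.
  fold-bound zero D h k C _ _ C-inverse = nonneg⇒≤ (ι (r ℚ.* r)) ((h * h) * (C * C)) (nonneg-ext
    (nonneg-+
      (nonneg-*ˡ (ι (r ℚ.* r) * (C * C)) (λ n → *-nonneg (0≤p*p r) (0≤p*p (seq C n)))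
        (≤⇒nonneg (sin x * sin x) (x * x) (sin²≤² x)))
      (null⇒nonneg (null-*ˡ (ι (r ℚ.* r) * (C * sin x + ι 1ℚ)) C-inverse)))
    (λ n → trans (expand r (odd k) (seq h n) (seq C n) (seq (sin x) n))
      (trans (cong (λ t → t ℚ.* t ℚ.* ((seq h n ℚ.* seq h n) ℚ.* (seq C n ℚ.* seq C n)) ℚ.- r ℚ.* r)
               (trans (ℚP.*-comm r (odd k)) (suc*recip (2 ℕ.* k))))
        (cong (ℚ._- r ℚ.* r) (ℚP.*-identityˡ ((seq h n ℚ.* seq h n) ℚ.* (seq C n ℚ.* seq C n)))))))
    where
    r = recip (2 ℕ.* k)
    x = ι (odd k) * h
    expand : ∀ r m h C S →
      (r ℚ.* r) ℚ.* (C ℚ.* C) ℚ.* ((m ℚ.* h) ℚ.* (m ℚ.* h) ℚ.- S ℚ.* S)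
        ℚ.+ (r ℚ.* r) ℚ.* (C ℚ.* S ℚ.+ 1ℚ) ℚ.* (C ℚ.* S ℚ.- 1ℚ) ≡
      (r ℚ.* m) ℚ.* (r ℚ.* m) ℚ.* ((h ℚ.* h) ℚ.* (C ℚ.* C)) ℚ.- r ℚ.* r
    expand = solve 5 (λ r m h C S →
      (r :* r) :* (C :* C) :* ((m :* h) :* (m :* h) :- S :* S)
        :+ (r :* r) :* (C :* S :+ con 1ℚ) :* (C :* S :- con 1ℚ) :=
      (r :* m) :* (r :* m) :* ((h :* h) :* (C :* C)) :- r :* r) refl
  fold-bound (suc e) D h k C 2Dh≡½π k<D C-inverse =
    nonneg⇒≤ (ι (F₁ ℚ.+ F₂)) ((h * h) * (C * C)) (nonneg-ext
      (nonneg-+ (nonneg-+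
        (≤⇒nonneg (ι F₁) ((h′ * h′) * (C₁ * C₁))
          (fold-bound e (D ℕ.+ D) h′ k C₁ 2Dh′≡½π (ℕP.≤-trans k<D (ℕP.m≤m+n D D)) C₁-inverse))
        (≤⇒nonneg (ι F₂) ((h′ * h′) * (C₂ * C₂))
          (fold-bound e (D ℕ.+ D) h′ j C₂ 2Dh′≡½π j<D+D C₂-inverse)))
        -- The factor ¼ in h′² cancels the 4 in C₁² and C₂², so the children add up to h² C² (cos² y
        -- + s² sin² y); this correction turns the bracket into 1.
        (null⇒nonneg (null-neg (null-*ˡ ((h * h) * (C * C))
          (null-+ (cos²+sin² y) (null-*ˡ (sin y * sin y) sin²-½π))))))
      (λ n → total F₁ F₂ (seq h n) (seq C n) (seq (sin y) n) (seq (cos y) n) (seq s n)))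
    where
    j = (D ℕ.+ D) ℕ.∸ suc k
    h′ = ι ½ * h
    x = ι (odd k) * h
    y = ι (odd k) * h′
    z = ι (odd j) * h′
    C₁ = ι (ℕ→ℚ 2) * (cos y * C)
    C₂ = ι (ℕ→ℚ 2) * (s * (sin y * C))
    F₁ = fold e (D ℕ.+ D) inv-odd² k
    F₂ = fold e (D ℕ.+ D) inv-odd² j
    j<D+D : j ℕ.< D ℕ.+ D
    j<D+D = ℕP.∸-monoʳ-< {D ℕ.+ D} {suc k} {0} (ℕ.s≤s ℕ.z≤n) (ℕP.≤-trans k<D (ℕP.m≤m+n D D))
    2Dh′≡½π : ∀ n → ℕ→ℚ ((D ℕ.+ D) ℕ.+ (D ℕ.+ D)) ℚ.* seq h′ n ≡ seq ½π n
    2Dh′≡½π n = trans (cong (ℚ._* seq h′ n) (ℤ→ℚ-+ (+ (D ℕ.+ D)) (+ (D ℕ.+ D))))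
      (trans (solve 2 (λ d h → (d :+ d) :* (con ½ :* h) := d :* h) refl (ℕ→ℚ (D ℕ.+ D)) (seq h n))
        (2Dh≡½π n))
    y+y≡x : ∀ n → seq y n ℚ.+ seq y n ≡ seq x n
    y+y≡x n = solve 2 (λ m h → m :* (con ½ :* h) :+ m :* (con ½ :* h) := m :* h) refl
      (odd k) (seq h n)
    z≡½π-y : ∀ n → seq z n ≡ seq ½π n ℚ.- seq y n
    z≡½π-y n = trans
      (cong (ℚ._* seq h′ n) (odd-reflect (D ℕ.+ D) k (ℕP.≤-trans k<D (ℕP.m≤m+n D D))))
      (trans (solve 3 (λ a b h → (a :- b) :* h := a :* h :- b :* h) refl
               (ℕ→ℚ ((D ℕ.+ D) ℕ.+ (D ℕ.+ D))) (odd k) (seq h′ n))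
        (cong (ℚ._- seq y n) (2Dh′≡½π n)))
    C₁-inverse : C₁ * sin y ≈ ι 1ℚ
    C₁-inverse = null-ext (null-- C-inverse (null-*ˡ C (sin-double x y y+y≡x)))
      (λ n → solve 4 (λ S C s c → (C :* S :- con 1ℚ) :- C :* (S :- (s :* c :+ c :* s))
          := (con (ℕ→ℚ 2) :* (c :* C)) :* s :- con 1ℚ) refl
        (seq (sin x) n) (seq C n) (seq (sin y) n) (seq (cos y) n))
    C₂-inverse : C₂ * sin z ≈ ι 1ℚ
    C₂-inverse = null-ext
      (null-+ (null-+ (null-*ˡ C₂ (sin-complement y z z≡½π-y))
        (null-*ˡ (C₁ * sin y) sin²-½π)) C₁-inverse)
      (λ n → solve 5 (λ z C a s c →
          ((con (ℕ→ℚ 2) :* (a :* (s :* C))) :* (z :- a :* c)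
            :+ (con (ℕ→ℚ 2) :* (c :* C)) :* s :* (a :* a :- con 1ℚ))
            :+ ((con (ℕ→ℚ 2) :* (c :* C)) :* s :- con 1ℚ)
          := (con (ℕ→ℚ 2) :* (a :* (s :* C))) :* z :- con 1ℚ) refl
        (seq (sin z) n) (seq C n) (seq s n) (seq (sin y) n) (seq (cos y) n))
    total : ∀ F₁ F₂ h C s c a → let h′ = ½ ℚ.* h
                                    C₁ = ℕ→ℚ 2 ℚ.* (c ℚ.* C)
                                    C₂ = ℕ→ℚ 2 ℚ.* (a ℚ.* (s ℚ.* C)) in
      ((h′ ℚ.* h′) ℚ.* (C₁ ℚ.* C₁) ℚ.- F₁) ℚ.+ ((h′ ℚ.* h′) ℚ.* (C₂ ℚ.* C₂) ℚ.- F₂)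
        ℚ.+ (ℚ.- ((h ℚ.* h) ℚ.* (C ℚ.* C) ℚ.*
          ((c ℚ.* c ℚ.+ s ℚ.* s ℚ.- 1ℚ) ℚ.+ (s ℚ.* s) ℚ.* (a ℚ.* a ℚ.- 1ℚ)))) ≡
      (h ℚ.* h) ℚ.* (C ℚ.* C) ℚ.- (F₁ ℚ.+ F₂)
    total = solve 7 (λ F₁ F₂ h C s c a → let h′ = con ½ :* h
                                             C₁ = con (ℕ→ℚ 2) :* (c :* C)
                                             C₂ = con (ℕ→ℚ 2) :* (a :* (s :* C)) in
      ((h′ :* h′) :* (C₁ :* C₁) :- F₁) :+ ((h′ :* h′) :* (C₂ :* C₂) :- F₂)
        :+ (:- ((h :* h) :* (C :* C) :* ((c :* c :+ s :* s :- con 1ℚ) :+ (s :* s) :* (a :* a :- con 1ℚ))))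
      := (h :* h) :* (C :* C) :- (F₁ :+ F₂)) refl

  -- At the root y = h = π/4. From 2 sin y cos y = s and s² = 1, the product 2 s cos y inverts sin
  -- y. Then 8 h² C² becomes 2 π² cos² y, which is π² (1 + cos (π/2)) = π².
  odd-basel : ∀ n → ι (ℕ→ℚ 8 ℚ.* partial inv-odd² n) ≤ π * π
  odd-basel n = nonneg⇒≤ (ι (ℕ→ℚ 8 ℚ.* P)) (π * π) (nonneg-ext
    (nonneg-+ (nonneg-+
      (nonneg-*ˡ (ι (ℕ→ℚ 8)) (λ _ → ℕ→ℚ-nonneg 8)
        (≤⇒nonneg (ι F) ((h * h) * (C * C))
          (fold-bound n 1 h 0 C 2h≡½π (ℕ.s≤s ℕ.z≤n) C-inverse)))
      (pointwise⇒nonneg {λ _ → ℕ→ℚ 8 ℚ.* (F ℚ.- P)} (λ _ →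
        *-nonneg (ℕ→ℚ-nonneg 8) (0≤-diff (partial≤fold n)))))
      (null⇒nonneg (null-neg (null-*ˡ (π * π)
        (null-+ (null-*ˡ (ι (ℕ→ℚ 2) * (cos y * cos y)) sin²-½π)
          (null-+ (cos²+sin² y) (null-- cos-½π (cos-double ½π y y+y≡½π))))))))
    (λ n → total P F (seq π n) (seq (cos y) n) (seq (sin y) n) (seq s n) (seq c n)))
    where
    P = partial inv-odd² n
    F = fold n 1 inv-odd² 0
    h = ι ½ * ½π
    y = ι (odd 0) * h
    C = ι (ℕ→ℚ 2) * (cos y * s)
    2h≡½π : ∀ n → ℕ→ℚ 2 ℚ.* seq h n ≡ seq ½π n
    2h≡½π n = solve 1 (λ p → con (ℕ→ℚ 2) :* (con ½ :* (con ½ :* p)) := con ½ :* p) refl (seq π n)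
    y+y≡½π : ∀ n → seq y n ℚ.+ seq y n ≡ seq ½π n
    y+y≡½π n = solve 1 (λ p → con 1ℚ :* (con ½ :* (con ½ :* p)) :+ con 1ℚ :* (con ½ :* (con ½ :* p))
      := con ½ :* p) refl (seq π n)
    C-inverse : C * sin y ≈ ι 1ℚ
    C-inverse = null-ext (null-- sin²-½π (null-*ˡ s (sin-double ½π y y+y≡½π)))
      (λ n → solve 3 (λ a s c → (a :* a :- con 1ℚ) :- a :* (a :- (s :* c :+ c :* s))
          := (con (ℕ→ℚ 2) :* (c :* a)) :* s :- con 1ℚ) refl
        (seq s n) (seq (sin y) n) (seq (cos y) n))
    total : ∀ P F p cy sy a c → let h = ½ ℚ.* (½ ℚ.* p)
                                    C = ℕ→ℚ 2 ℚ.* (cy ℚ.* a) in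
      ℕ→ℚ 8 ℚ.* ((h ℚ.* h) ℚ.* (C ℚ.* C) ℚ.- F) ℚ.+ ℕ→ℚ 8 ℚ.* (F ℚ.- P) ℚ.+
        (ℚ.- (p ℚ.* p ℚ.* ((ℕ→ℚ 2 ℚ.* (cy ℚ.* cy)) ℚ.* (a ℚ.* a ℚ.- 1ℚ) ℚ.+
          ((cy ℚ.* cy ℚ.+ sy ℚ.* sy ℚ.- 1ℚ) ℚ.+ (c ℚ.- (c ℚ.- (cy ℚ.* cy ℚ.- sy ℚ.* sy)))))))
      ≡ p ℚ.* p ℚ.- ℕ→ℚ 8 ℚ.* P
    total = solve 7 (λ P F p cy sy a c → let h = con ½ :* (con ½ :* p)
                                             C = con (ℕ→ℚ 2) :* (cy :* a) in
      con (ℕ→ℚ 8) :* ((h :* h) :* (C :* C) :- F) :+ con (ℕ→ℚ 8) :* (F :- P) :+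
        (:- (p :* p :* ((con (ℕ→ℚ 2) :* (cy :* cy)) :* (a :* a :- con 1ℚ) :+
          ((cy :* cy :+ sy :* sy :- con 1ℚ) :+ (c :- (c :- (cy :* cy :- sy :* sy)))))))
      := p :* p :- con (ℕ→ℚ 8) :* P) refl

-- Series dominated by ∑ 1 / (j+1)²

recip-nonneg : ∀ n → 0ℚ ℚ.≤ recip n
recip-nonneg n = ℚP.<⇒≤ (recip-pos n)

recip-antitone : ∀ {m n} → m ℕ.≤ n → recip n ℚ.≤ recip m
recip-antitone {m} {n} m≤n = subst₂ ℚ._≤_
  (trans (cong (recip n ℚ.*_) (suc*recip m)) (ℚP.*-identityʳ (recip n)))
  (trans (solve 3 (λ r s p → r :* (p :* s) := (p :* r) :* s) refl
           (recip n) (recip m) (ℕ→ℚ (suc n)))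
    (trans (cong (ℚ._* recip m) (suc*recip n)) (ℚP.*-identityˡ (recip m))))
  (ℚP.*-monoˡ-≤-nonNeg (recip n) {{ℚ.nonNegative (recip-nonneg n)}}
    (ℚP.*-monoʳ-≤-nonNeg (recip m) {{ℚ.nonNegative (recip-nonneg m)}}
      (ℕ→ℚ-mono (ℕ.s≤s m≤n))))

/-square : ∀ m n → + m ℚ./ (suc n ℕ.* suc n) ≡ ℕ→ℚ m ℚ.* (recip n ℚ.* recip n)
/-square m n = ℚP.toℚᵘ-injective
  -- The second argument is (n + 1)² - 1, since `mkℚᵘ` stores the predecessor of the denominator.
  (ℚᵘP.≃-trans (ℚP.toℚᵘ-fromℚᵘ (ℚᵘ.mkℚᵘ (+ m) (n ℕ.+ n ℕ.* suc n)))
  (ℚᵘP.≃-trans (ℚᵘ.*≡* (cong₂ ℤ._*_ (sym (ℤP.*-identityʳ (+ m)))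
      (cong +_ (ℕP.*-identityˡ (suc n ℕ.* suc n)))))
  (ℚᵘP.≃-sym (ℚᵘP.≃-trans (ℚP.toℚᵘ-homo-* (ℕ→ℚ m) (recip n ℚ.* recip n))
    (ℚᵘP.*-cong (toℚᵘ-ℤ (+ m)) (ℚᵘP.≃-trans (ℚP.toℚᵘ-homo-* (recip n) (recip n))
      (ℚᵘP.*-cong (toℚᵘ-recip n) (toℚᵘ-recip n))))))))

-- The gap is j / ((j+1)² (j+2)). The factor 2 absorbs the quotient (j+2) / (j+1), so telescoping
-- works from index 0 on, where equality holds.
recip²≤ : ∀ j → recip j ℚ.* recip j ℚ.≤ ℕ→ℚ 2 ℚ.* (recip j ℚ.- recip (suc j))
recip²≤ j = diff-0≤ (subst (0ℚ ℚ.≤_) (sym difference)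
  (*-nonneg (recip-nonneg j) (*-nonneg (recip-nonneg j)
    (*-nonneg (recip-nonneg (suc j)) (ℕ→ℚ-nonneg j)))))
  where
  a = recip j
  b = recip (suc j)
  N = ℕ→ℚ j
  a*suc : a ℚ.* (1ℚ ℚ.+ N) ≡ 1ℚ
  a*suc = trans (ℚP.*-comm a _) (trans (cong (ℚ._* a) (sym (ℕ→ℚ-suc j))) (suc*recip j))
  b*suc : b ℚ.* (1ℚ ℚ.+ (1ℚ ℚ.+ N)) ≡ 1ℚ
  b*suc = trans (ℚP.*-comm b _) (trans
    (cong (ℚ._* b) (sym (trans (ℕ→ℚ-suc (suc j)) (cong (1ℚ ℚ.+_) (ℕ→ℚ-suc j)))))
    (suc*recip (suc j)))
  difference : ℕ→ℚ 2 ℚ.* (a ℚ.- b) ℚ.- a ℚ.* a ≡ a ℚ.* (a ℚ.* (b ℚ.* N))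
  difference = trans
    -- Factors 1 are inserted and then replaced by a (1 + j) and b (2 + j), which turns the claim
    -- into a polynomial identity.
    (solve 2 (λ a b → con (ℕ→ℚ 2) :* (a :- b) :- a :* a
      := con (ℕ→ℚ 2) :* (a :* con 1ℚ :- con 1ℚ :* b) :* con 1ℚ :- a :* a :* con 1ℚ) refl a b)
    (trans (sym (cong₂ (λ u v → ℕ→ℚ 2 ℚ.* (a ℚ.* v ℚ.- u ℚ.* b) ℚ.* u ℚ.- a ℚ.* a ℚ.* v) a*suc b*suc))
      (solve 3 (λ a b N → let u = a :* (con 1ℚ :+ N)
                              v = b :* (con 1ℚ :+ (con 1ℚ :+ N)) in
        con (ℕ→ℚ 2) :* (a :* v :- u :* b) :* u :- a :* a :* v := a :* (a :* (b :* N))) refl a b N))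

⟶-close : ∀ f L → f ⟶ L → ∀ ε → 0ℚ ℚ.< ε → ∃ λ N → ∀ n → N ℕ.≤ n →
  NonNeg (λ k → ε ℚ.- (seq L k ℚ.- seq (f n) k)) × NonNeg (λ k → ε ℚ.- (seq (f n) k ℚ.- seq L k))
⟶-close f L f⟶L ε 0<ε = let (N , h) = f⟶L ε 0<ε in N , λ n p →
    nonneg (λ δ 0<δ → let (K , g) = h n p δ 0<δ in K , λ k q →
      bound {e = ε} {δ} (ℚP.≤-trans (p≤∣p∣ (seq L k ℚ.- seq (f n) k))
        (subst (ℚ._≤ ε ℚ.+ δ) (∣p-q∣≡∣q-p∣ (seq (f n) k) (seq L k)) (g k q))))
  , nonneg (λ δ 0<δ → let (K , g) = h n p δ 0<δ in K , λ k q →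
      bound {e = ε} {δ} (ℚP.≤-trans (p≤∣p∣ (seq (f n) k ℚ.- seq L k)) (g k q)))
  where
  bound : ∀ {d e δ : ℚ} → d ℚ.≤ e ℚ.+ δ → 0ℚ ℚ.≤ e ℚ.- d ℚ.+ δ
  bound {d} {e} {δ} le = subst (0ℚ ℚ.≤_)
    (solve 3 (λ d e δ → e :+ δ :- d := e :- d :+ δ) refl d e δ) (0≤-diff le)

scaled-limit-≤ : ∀ n (f : ℕ → ℝ) L X → f ⟶ L → (∀ m → ι (ℕ→ℚ (suc n)) * f m ≤ X) →
  ι (ℕ→ℚ (suc n)) * L ≤ X
scaled-limit-≤ n f L X f⟶L f≤X = nonneg⇒≤ (ι N * L) X (nonneg-closed λ ε 0<ε →
  let η = ε ℚ.* recip n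
      (m , close) = ⟶-close f L f⟶L η (*-pos 0<ε (recip-pos n))
  in nonneg-ext
       (nonneg-+ (≤⇒nonneg (ι N * f m) X (f≤X m))
         (nonneg-*ˡ (ι N) (λ _ → ℕ→ℚ-nonneg (suc n)) (proj₁ (close m ℕP.≤-refl))))
       (λ k → trans
         (solve 5 (λ N X f L η → (X :- N :* f) :+ N :* (η :- (L :- f)) := X :- N :* L :+ N :* η)
           refl N (seq X k) (seq (f m) k) (seq L k) η)
         (cong (λ t → seq X k ℚ.- N ℚ.* seq L k ℚ.+ t) (scale-cancel n ε))))
  where N = ℕ→ℚ (suc n)

distance-sym : ∀ x y z → ∣ x - y ∣ ≤ z → ∣ y - x ∣ ≤ z
distance-sym x y z h ε 0<ε = let (N , k) = h ε 0<ε in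
  N , λ n p → subst (ℚ._≤ seq z n ℚ.+ ε) (∣p-q∣≡∣q-p∣ (seq x n) (seq y n)) (k n p)

module _ (q : ℕ → ℚ) (v : ℕ → ℝ) (c M : ℚ)
  (0≤q : ∀ j → 0ℚ ℚ.≤ q j) (q≤ : ∀ j → q j ℚ.≤ c ℚ.* (recip j ℚ.* recip j)) (0≤c : 0ℚ ℚ.≤ c)
  (0≤v : ∀ j k → 0ℚ ℚ.≤ seq (v j) k) (v≤ : ∀ j → v j ≤ ι M) (0≤M : 0ℚ ℚ.≤ M) where

  private
    term : ℕ → ℝ
    term j = ι (q j) * v j

    S : ℕ → ℝ
    S n = ∑ n term

    D = c ℚ.* ℕ→ℚ 2 ℚ.* M

    0≤D : 0ℚ ℚ.≤ D
    0≤D = *-nonneg (*-nonneg 0≤c (ℕ→ℚ-nonneg 2)) 0≤M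

    -- Valid at every index k of the approximating sequences, as `0≤v` is; in `S-close` the absolute
    -- value can therefore be dropped.
    S-mono : ∀ d n k → 0ℚ ℚ.≤ seq (S (d ℕ.+ n)) k ℚ.- seq (S n) k
    S-mono zero    n k = ℚP.≤-reflexive (sym (ℚP.+-inverseʳ (seq (S n) k)))
    S-mono (suc d) n k = subst (0ℚ ℚ.≤_)
      (solve 3 (λ s t u → (s :- t) :+ u := (s :+ u) :- t) refl
        (seq (S (d ℕ.+ n)) k) (seq (S n) k) (seq (term (d ℕ.+ n)) k))
      (ℚP.+-mono-≤ (S-mono d n k) (*-nonneg (0≤q (d ℕ.+ n)) (0≤v (d ℕ.+ n) k)))

    -- Each new term is at most q M, and `recip²≤` bounds q by 2c times a difference of consecutive
    -- reciprocals. With D = 2cM these differences telescope.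
    S-tail : ∀ d n → NonNeg (λ k →
      D ℚ.* (recip n ℚ.- recip (d ℕ.+ n)) ℚ.- (seq (S (d ℕ.+ n)) k ℚ.- seq (S n) k))
    S-tail zero n = null⇒nonneg (≡⇒null λ k →
      solve 3 (λ D r s → D :* (r :- r) :- (s :- s) := con 0ℚ) refl D (recip n) (seq (S n) k))
    S-tail (suc d) n = nonneg-ext
      (nonneg-+ (S-tail d n) (nonneg-+
        (nonneg-*ˡ (ι (q j)) (λ _ → 0≤q j) (≤⇒nonneg (v j) (ι M) (v≤ j)))
        (pointwise⇒nonneg {λ _ → (c ℚ.* (ℕ→ℚ 2 ℚ.* (recip j ℚ.- recip (suc j))) ℚ.- q j) ℚ.* M} λ _ →
          *-nonneg (0≤-diff (ℚP.≤-trans (q≤ j)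
            (ℚP.*-monoˡ-≤-nonNeg c {{ℚ.nonNegative 0≤c}} (recip²≤ j)))) 0≤M)))
      (λ k → identity c M (recip n) (recip j) (recip (suc j)) (q j)
        (seq (S (d ℕ.+ n)) k) (seq (S n) k) (seq (v j) k))
      where
      j = d ℕ.+ n
      identity : ∀ c M r s t q S S₀ v → let D = c ℚ.* ℕ→ℚ 2 ℚ.* M in
        (D ℚ.* (r ℚ.- s) ℚ.- (S ℚ.- S₀)) ℚ.+
          (q ℚ.* (M ℚ.- v) ℚ.+ (c ℚ.* (ℕ→ℚ 2 ℚ.* (s ℚ.- t)) ℚ.- q) ℚ.* M) ≡
        D ℚ.* (r ℚ.- t) ℚ.- ((S ℚ.+ q ℚ.* v) ℚ.- S₀)
      identity = solve 9 (λ c M r s t q S S₀ v → let D = c :* con (ℕ→ℚ 2) :* M in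
        (D :* (r :- s) :- (S :- S₀)) :+
          (q :* (M :- v) :+ (c :* (con (ℕ→ℚ 2) :* (s :- t)) :- q) :* M) :=
        D :* (r :- t) :- ((S :+ q :* v) :- S₀)) refl

    S-close : ∀ {ε} d n → D ℚ.* recip n ℚ.≤ ε → ∀ δ → 0ℚ ℚ.< δ →
      ∃ λ K → ∀ k → K ℕ.≤ k → ℚ.∣ seq (S (d ℕ.+ n)) k ℚ.- seq (S n) k ∣ ℚ.≤ ε ℚ.+ δ
    S-close {ε} d n Dr≤ε δ 0<δ = let (K , h) = 0≤f+ε (S-tail d n) δ 0<δ in
      K , λ k p → let X = seq (S (d ℕ.+ n)) k ℚ.- seq (S n) k in
        subst (ℚ._≤ ε ℚ.+ δ) (sym (ℚP.0≤p⇒∣p∣≡p (S-mono d n k)))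
          (ℚP.≤-trans
            (diff-0≤ (subst (0ℚ ℚ.≤_)
              (solve 5 (λ D r s X δ → D :* (r :- s) :- X :+ δ :+ D :* s := (D :* r :+ δ) :- X) refl
                D (recip n) (recip (d ℕ.+ n)) X δ)
              (ℚP.+-mono-≤ (h k p) (*-nonneg 0≤D (recip-nonneg (d ℕ.+ n))))))
            (ℚP.+-monoˡ-≤ δ Dr≤ε))

    S-cauchy : Cauchy S
    S-cauchy ε 0<ε = N , both
      where
      B = ℤ.∣ ℚ.↥ D ∣
      η = ε ℚ.* recip B
      0<η = *-pos 0<ε (recip-pos B)
      N = proj₁ (archimedean η 0<η)
      small : ∀ n → N ℕ.≤ n → D ℚ.* recip n ℚ.≤ ε
      small n p = subst (D ℚ.* recip n ℚ.≤_) (scale-cancel B ε)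
        (*-mono-≤-nonneg {D} {ℕ→ℚ (suc B)} {recip n} {η} (ℕ→ℚ-nonneg (suc B)) (recip-nonneg n)
          (ℚP.≤-trans (p≤∣p∣ D) (∣q∣≤ℕ D)) (proj₂ (archimedean η 0<η) n p))
      ordered : ∀ m n → N ℕ.≤ n → n ℕ.≤ m → ∣ S m - S n ∣ ≤ ι ε
      ordered m n N≤n n≤m = subst (λ i → ∣ S i - S n ∣ ≤ ι ε) (ℕP.m∸n+n≡m n≤m)
        (S-close (m ℕ.∸ n) n (small n N≤n))
      both : ∀ m n → N ℕ.≤ m → N ℕ.≤ n → ∣ S m - S n ∣ ≤ ι ε
      both m n N≤m N≤n = [ ordered m n N≤n
                         , (λ m≤n → distance-sym (S n) (S m) (ι ε) (ordered n m N≤m m≤n))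
                         ]′ (ℕP.≤-total n m)

  -- The bound on partial sums is returned too: it lets the final estimate replace a finite part of
  -- the right-hand series by its sum.
  series-sum : ∃ λ s → HasSum (λ j → ι (q j) * v j) s × (∀ n → ∑ n (λ j → ι (q j) * v j) ≤ s)
  series-sum = lim S S-cauchy , lim-⟶ S S-cauchy , λ n → nonneg⇒≤ (S n) L (nonneg-closed (below n))
    where
    L = lim S S-cauchy
    below : ∀ n ε → 0ℚ ℚ.< ε → NonNeg (λ k → seq L k ℚ.- seq (S n) k ℚ.+ ε)
    below n ε 0<ε =
      let (N , close) = ⟶-close S L (lim-⟶ S S-cauchy) ε 0<ε
      in nonneg-ext
           (nonneg-+ (proj₂ (close (N ℕ.+ n) (ℕP.m≤m+n N n))) (pointwise⇒nonneg (S-mono N n)))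
           (λ k → identity ε (seq L k) (seq (S n) k) (seq (S (N ℕ.+ n)) k))
      where
      identity : ∀ e l s t → (e ℚ.- (t ℚ.- l)) ℚ.+ (t ℚ.- s) ≡ l ℚ.- s ℚ.+ e
      identity = solve 4 (λ e l s t → (e :- (t :- l)) :+ (t :- s) := l :- s :+ e) refl

-- Trigonometric sums

∣∣²-nonneg : ∀ z k → 0ℚ ℚ.≤ seq ∣ z ∣² k
∣∣²-nonneg z k = ℚP.+-mono-≤ (0≤p*p (seq (re z) k)) (0≤p*p (seq (im z) k))

sumBound : ℕ → ℚ
sumBound zero    = 0ℚ
sumBound (suc N) = ℕ→ℚ 2 ℚ.+ ℕ→ℚ 2 ℚ.* sumBound N

sumBound-nonneg : ∀ N → 0ℚ ℚ.≤ sumBound N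
sumBound-nonneg zero    = ℚP.≤-refl
sumBound-nonneg (suc N) = ℚP.+-mono-≤ (ℕ→ℚ-nonneg 2)
  (*-nonneg (ℕ→ℚ-nonneg 2) (sumBound-nonneg N))

-- From |z + w|² ≤ 2 |z|² + 2 |w|²; any bound uniform in the frequency suffices.
exp-sum-bounded : ∀ N (θ : Fin N → ℝ) →
  ∣ foldr _+ᶜ_ 0ᶜ (λ i → exp (mkℂ (ι 0ℚ) (θ i))) ∣² ≤ ι (sumBound N)
exp-sum-bounded zero    θ = nonneg⇒≤ ∣ 0ᶜ ∣² (ι 0ℚ) (null⇒nonneg (≡⇒null λ _ → refl))
exp-sum-bounded (suc N) θ = nonneg⇒≤ ∣ z +ᶜ w ∣² (ι (sumBound (suc N))) (nonneg-ext
  (nonneg-+ (nonneg-+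
    (pointwise⇒nonneg (λ k → ℚP.+-mono-≤
      (0≤p*p (seq (re z) k ℚ.- seq (re w) k)) (0≤p*p (seq (im z) k ℚ.- seq (im w) k))))
    (nonneg-*ˡ (ι (ℕ→ℚ 2)) (λ _ → ℕ→ℚ-nonneg 2)
      (≤⇒nonneg ∣ w ∣² (ι (sumBound N)) (exp-sum-bounded N (θ ∘ Fin.suc)))))
    (null⇒nonneg (null-neg (null-*ˡ (ι (ℕ→ℚ 2)) (cos²+sin² (θ Fin.zero))))))
  (λ k → identity (seq (re z) k) (seq (im z) k) (seq (re w) k) (seq (im w) k) (sumBound N)))
  where
  z = exp (mkℂ (ι 0ℚ) (θ Fin.zero))
  w = foldr _+ᶜ_ 0ᶜ (λ i → exp (mkℂ (ι 0ℚ) (θ (Fin.suc i))))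
  identity : ∀ a b c d M →
    ((a ℚ.- c) ℚ.* (a ℚ.- c) ℚ.+ (b ℚ.- d) ℚ.* (b ℚ.- d)) ℚ.+
      ℕ→ℚ 2 ℚ.* (M ℚ.- (c ℚ.* c ℚ.+ d ℚ.* d)) ℚ.+
      (ℚ.- (ℕ→ℚ 2 ℚ.* (a ℚ.* a ℚ.+ b ℚ.* b ℚ.- 1ℚ))) ≡
    (ℕ→ℚ 2 ℚ.+ ℕ→ℚ 2 ℚ.* M) ℚ.- ((a ℚ.+ c) ℚ.* (a ℚ.+ c) ℚ.+ (b ℚ.+ d) ℚ.* (b ℚ.+ d))
  identity = solve 5 (λ a b c d M →
    ((a :- c) :* (a :- c) :+ (b :- d) :* (b :- d)) :+
      con (ℕ→ℚ 2) :* (M :- (c :* c :+ d :* d)) :+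
      (:- (con (ℕ→ℚ 2) :* (a :* a :+ b :* b :- con 1ℚ))) :=
    (con (ℕ→ℚ 2) :+ con (ℕ→ℚ 2) :* M) :- ((a :+ c) :* (a :+ c) :+ (b :+ d) :* (b :+ d))) refl

-- Indices start at 0 and frequencies at 1, so in the application the even indices carry the odd
-- frequencies, and nonnegative terms of even frequency are added.
∑-even≤∑ : ∀ (b : ℕ → ℝ) k → (∀ j → 0ℚ ℚ.≤ seq (b j) k) → ∀ n →
  seq (∑ n (λ j → b (2 ℕ.* j))) k ℚ.≤ seq (∑ (n ℕ.+ n) b) k
∑-even≤∑ b k 0≤b zero    = ℚP.≤-refl
∑-even≤∑ b k 0≤b (suc n) = subst (λ m → seq (∑ (suc n) (λ j → b (2 ℕ.* j))) k ℚ.≤ seq (∑ m b) k)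
  (cong suc (sym (ℕP.+-suc n n)))
  (ℚP.≤-trans
    (ℚP.+-mono-≤ (∑-even≤∑ b k 0≤b n)
      (ℚP.≤-reflexive (cong (λ m → seq (b (n ℕ.+ m)) k) (ℕP.+-identityʳ n))))
    (p≤p+q (0≤b (suc (n ℕ.+ n)))))

-- Summation of the termwise inequality

module _ (π : ℝ) (isPi : IsPi π) (N′ : ℕ) (u : ℕ → ℝ) (M : ℚ) (0≤M : 0ℚ ℚ.≤ M)
  (u-nonneg : ∀ k n → 0ℚ ℚ.≤ seq (u k) n) (u≤M : ∀ k → u k ≤ ι M) where

  private
    N = ℕ→ℚ (suc N′)

    u²≤M² : ∀ k → u k * u k ≤ ι (M ℚ.* M)
    u²≤M² k = nonneg⇒≤ (u k * u k) (ι (M ℚ.* M)) (nonneg-ext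
      (nonneg-*ˡ (ι M + u k) (λ n → ℚP.+-mono-≤ 0≤M (u-nonneg k n)) (≤⇒nonneg (u k) (ι M) (u≤M k)))
      (λ n → identity M (seq (u k) n)))
      where
      identity : ∀ m u → (m ℚ.+ u) ℚ.* (m ℚ.- u) ≡ m ℚ.* m ℚ.- u ℚ.* u
      identity = solve 2 (λ m u → (m :+ u) :* (m :- u) := m :* m :- u :* u) refl

    8/k²-nonneg : ∀ j → let k = suc (2 ℕ.* j) in 0ℚ ℚ.≤ + 8 ℚ./ (k ℕ.* k)
    8/k²-nonneg j = subst (0ℚ ℚ.≤_) (sym (/-square 8 (2 ℕ.* j)))
      (*-nonneg (ℕ→ℚ-nonneg 8) (0≤p*p (recip (2 ℕ.* j))))

    2/k²-nonneg : ∀ j → let k = suc j in 0ℚ ℚ.≤ + 2 ℚ./ (k ℕ.* k)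
    2/k²-nonneg j = subst (0ℚ ℚ.≤_) (sym (/-square 2 j))
      (*-nonneg (ℕ→ℚ-nonneg 2) (0≤p*p (recip j)))

    a b : ℕ → ℝ
    a j = let k = suc (2 ℕ.* j) in ι (+ 8 ℚ./ (k ℕ.* k)) * u k
    b j = let k = suc j in ι (+ 2 ℚ./ (k ℕ.* k)) * (u k * u k)

    b-nonneg : ∀ j n → 0ℚ ℚ.≤ seq (b j) n
    b-nonneg j n = *-nonneg (2/k²-nonneg j) (0≤p*p (seq (u (suc j)) n))

    A-series = series-sum (λ j → let k = suc (2 ℕ.* j) in + 8 ℚ./ (k ℕ.* k)) (λ j → u (suc (2 ℕ.* j))) (ℕ→ℚ 8) M 8/k²-nonneg
      (λ j → subst (ℚ._≤ ℕ→ℚ 8 ℚ.* (recip j ℚ.* recip j)) (sym (/-square 8 (2 ℕ.* j)))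
        (let le = recip-antitone {j} {2 ℕ.* j} (ℕP.m≤m+n j (j ℕ.+ 0)) in
         ℚP.*-monoˡ-≤-nonNeg (ℕ→ℚ 8) {{ℚ.nonNegative (ℕ→ℚ-nonneg 8)}}
           (*-mono-≤-nonneg (recip-nonneg j) (recip-nonneg (2 ℕ.* j)) le le)))
      (ℕ→ℚ-nonneg 8) (λ j → u-nonneg (suc (2 ℕ.* j))) (λ j → u≤M (suc (2 ℕ.* j))) 0≤M

    B-series = series-sum (λ j → let k = suc j in + 2 ℚ./ (k ℕ.* k)) (λ j → u (suc j) * u (suc j)) (ℕ→ℚ 2) (M ℚ.* M) 2/k²-nonneg
      (λ j → ℚP.≤-reflexive (/-square 2 j))
      (ℕ→ℚ-nonneg 2) (λ j n → 0≤p*p (seq (u (suc j)) n)) (λ j → u²≤M² (suc j)) (0≤p*p M)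

    A = proj₁ A-series
    B = proj₁ B-series

    A-sum : HasSum a A
    A-sum = proj₁ (proj₂ A-series)

    B-sum : HasSum b B
    B-sum = proj₁ (proj₂ B-series)

    -- 8 N u ≤ 2 u² + 8 N², because the difference is 2 (u - 2N)².
    term-≤ : ∀ j n → N ℚ.* seq (a j) n ℚ.≤
      seq (b (2 ℕ.* j)) n ℚ.+ (N ℚ.* N) ℚ.* (ℕ→ℚ 8 ℚ.* inv-odd² j)
    term-≤ j n = subst₂ ℚ._≤_ (cong (N ℚ.*_) a≡) (cong (ℚ._+ (N ℚ.* N) ℚ.* (ℕ→ℚ 8 ℚ.* R)) b≡)
      (diff-0≤ (subst (0ℚ ℚ.≤_) (identity R N U)
        (*-nonneg (*-nonneg (ℕ→ℚ-nonneg 2) (0≤p*p (recip (2 ℕ.* j))))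
          (0≤p*p (U ℚ.- ℕ→ℚ 2 ℚ.* N)))))
      where
      U = seq (u (suc (2 ℕ.* j))) n
      R = inv-odd² j
      a≡ : ℕ→ℚ 8 ℚ.* R ℚ.* U ≡ seq (a j) n
      a≡ = cong (ℚ._* U) (sym (/-square 8 (2 ℕ.* j)))
      b≡ : ℕ→ℚ 2 ℚ.* R ℚ.* (U ℚ.* U) ≡ seq (b (2 ℕ.* j)) n
      b≡ = cong (ℚ._* (U ℚ.* U)) (sym (/-square 2 (2 ℕ.* j)))
      identity : ∀ R N U →
        ℕ→ℚ 2 ℚ.* R ℚ.* ((U ℚ.- ℕ→ℚ 2 ℚ.* N) ℚ.* (U ℚ.- ℕ→ℚ 2 ℚ.* N)) ≡
        ℕ→ℚ 2 ℚ.* R ℚ.* (U ℚ.* U) ℚ.+ (N ℚ.* N) ℚ.* (ℕ→ℚ 8 ℚ.* R) ℚ.- N ℚ.* (ℕ→ℚ 8 ℚ.* R ℚ.* U)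
      identity = solve 3 (λ R N U →
        con (ℕ→ℚ 2) :* R :* ((U :- con (ℕ→ℚ 2) :* N) :* (U :- con (ℕ→ℚ 2) :* N)) :=
        con (ℕ→ℚ 2) :* R :* (U :* U) :+ (N :* N) :* (con (ℕ→ℚ 8) :* R) :- N :* (con (ℕ→ℚ 8) :* R :* U)) refl

    P : ℕ → ℚ
    P m = partial (inv-odd²) m

    partial-sum-≤ : ∀ m n → N ℚ.* seq (∑ m a) n ℚ.≤
      seq (∑ m (λ j → b (2 ℕ.* j))) n ℚ.+ (N ℚ.* N) ℚ.* (ℕ→ℚ 8 ℚ.* P m)
    partial-sum-≤ zero    n = ℚP.≤-reflexive
      (solve 1 (λ N → N :* con 0ℚ := con 0ℚ :+ (N :* N) :* (con (ℕ→ℚ 8) :* con 0ℚ)) refl N)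
    partial-sum-≤ (suc m) n = subst₂ ℚ._≤_
      (sym (ℚP.*-distribˡ-+ N (seq (∑ m a) n) (seq (a m) n)))
      (regroup N (seq (∑ m (λ j → b (2 ℕ.* j))) n) (seq (b (2 ℕ.* m)) n) (P m) (inv-odd² m))
      (ℚP.+-mono-≤ (partial-sum-≤ m n) (term-≤ m n))
      where
      regroup : ∀ N s t p r →
        (s ℚ.+ (N ℚ.* N) ℚ.* (ℕ→ℚ 8 ℚ.* p)) ℚ.+ (t ℚ.+ (N ℚ.* N) ℚ.* (ℕ→ℚ 8 ℚ.* r)) ≡
        (s ℚ.+ t) ℚ.+ (N ℚ.* N) ℚ.* (ℕ→ℚ 8 ℚ.* (p ℚ.+ r))
      regroup = solve 5 (λ N s t p r →
        (s :+ (N :* N) :* (con (ℕ→ℚ 8) :* p)) :+ (t :+ (N :* N) :* (con (ℕ→ℚ 8) :* r)) :=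
        (s :+ t) :+ (N :* N) :* (con (ℕ→ℚ 8) :* (p :+ r))) refl

    -- Enlarging the even-index sum to the first 2m terms bounds it by `B`, and `odd-basel` bounds
    -- the remaining N² · 8 P m by π² N².
    partial-sum-≤-limit : ∀ B → (∀ n → ∑ n b ≤ B) → ∀ m →
      ι N * ∑ m a ≤ B + (π * π) * (ι N * ι N)
    partial-sum-≤-limit B ∑≤B m = nonneg⇒≤ (ι N * ∑ m a) (B + (π * π) * (ι N * ι N)) (nonneg-ext
      (nonneg-+ (nonneg-+
        (≤⇒nonneg (∑ (m ℕ.+ m) b) B (∑≤B (m ℕ.+ m)))
        (pointwise⇒nonneg (λ n → 0≤-diff (ℚP.≤-trans (partial-sum-≤ m n)
          (ℚP.+-monoˡ-≤ ((N ℚ.* N) ℚ.* (ℕ→ℚ 8 ℚ.* P m))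
            (∑-even≤∑ b n (λ j → b-nonneg j n) m))))))
        (nonneg-*ˡ (ι N * ι N) (λ _ → 0≤p*p N)
          (≤⇒nonneg (ι (ℕ→ℚ 8 ℚ.* P m)) (π * π) (odd-basel π isPi m))))
      (λ n → identity N (seq B n) (seq (∑ m a) n) (seq (∑ (m ℕ.+ m) b) n) (P m) (seq π n)))
      where
      identity : ∀ N B a b P p →
        ((B ℚ.- b) ℚ.+ (b ℚ.+ (N ℚ.* N) ℚ.* (ℕ→ℚ 8 ℚ.* P) ℚ.- N ℚ.* a)) ℚ.+
          (N ℚ.* N) ℚ.* (p ℚ.* p ℚ.- ℕ→ℚ 8 ℚ.* P) ≡
        B ℚ.+ (p ℚ.* p) ℚ.* (N ℚ.* N) ℚ.- N ℚ.* a
      identity = solve 6 (λ N B a b P p →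
        ((B :- b) :+ (b :+ (N :* N) :* (con (ℕ→ℚ 8) :* P) :- N :* a)) :+
          (N :* N) :* (p :* p :- con (ℕ→ℚ 8) :* P) :=
        B :+ (p :* p) :* (N :* N) :- N :* a) refl

  inequality-suc : ∃ λ A → ∃ λ B →
    HasSum (λ j → let k = suc (2 ℕ.* j) in ι (+ 8 ℚ./ (k ℕ.* k)) * u k) A ×
    HasSum (λ j → let k = suc j in ι (+ 2 ℚ./ (k ℕ.* k)) * (u k * u k)) B ×
    ι (ℕ→ℚ (suc N′)) * A ≤ B + (π * π) * (ι (ℕ→ℚ (suc N′)) * ι (ℕ→ℚ (suc N′)))
  inequality-suc = A , B , A-sum , B-sum ,
    scaled-limit-≤ N′ (λ n → ∑ n a) A (B + (π * π) * (ι N * ι N)) A-sum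
      (partial-sum-≤-limit B (proj₂ (proj₂ B-series)))

-- The trigonometric sums enter only through u k = |Sₖ|², by its nonnegativity and a bound uniform
-- in k.
inequality-for-bounded : (π : ℝ) → IsPi π → (N : ℕ) → 1 ℕ.≤ N → (u : ℕ → ℝ) →
  (M : ℚ) → 0ℚ ℚ.≤ M → (∀ k n → 0ℚ ℚ.≤ seq (u k) n) → (∀ k → u k ≤ ι M) →
  ∃ λ A → ∃ λ B →
    HasSum (λ j → let k = suc (2 ℕ.* j) in ι (+ 8 ℚ./ (k ℕ.* k)) * u k) A ×
    HasSum (λ j → let k = suc j in ι (+ 2 ℚ./ (k ℕ.* k)) * (u k * u k)) B ×
    ι (ℕ→ℚ N) * A ≤ B + (π * π) * (ι (ℕ→ℚ N) * ι (ℕ→ℚ N))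
inequality-for-bounded π isPi (suc N′) _ = inequality-suc π isPi N′

trigSum-bounded : ∀ π {N} (x : Fin N → ℝ) k → ∣ trigSum π x k ∣² ≤ ι (sumBound N)
trigSum-bounded π {N} x k = subst (λ z → ∣ z ∣² ≤ ι (sumBound N)) unfold
  (exp-sum-bounded N (λ i → ι (ℕ→ℚ 2) * π * ι (ℕ→ℚ k) * x i))
  where
  unfold : foldr _+ᶜ_ 0ᶜ (λ i → exp (mkℂ (ι 0ℚ) (ι (ℕ→ℚ 2) * π * ι (ℕ→ℚ k) * x i))) ≡ trigSum π x k
  unfold = refl

mainTheorem5 : (π : ℝ) → IsPi π →
    (N : ℕ) → 1 ℕ.≤ N → (x : Fin N → Setoid.Carrier 𝕋) →
    ∃ λ A → ∃ λ B →
    HasSum (λ j → let k = suc (2 ℕ.* j) in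
    ι (+ 8 ℚ./ (k ℕ.* k)) * ∣ trigSum π x k ∣²) A ×
    HasSum (λ j → let k = suc j in
    ι (+ 2 ℚ./ (k ℕ.* k)) * (∣ trigSum π x k ∣² * ∣ trigSum π x k ∣²)) B ×
    ι (ℕ→ℚ N) * A ≤ B + (π * π) * (ι (ℕ→ℚ N) * ι (ℕ→ℚ N))
mainTheorem5 π isPi N 1≤N x = inequality-for-bounded π isPi N 1≤N
  (λ k → ∣ trigSum π x k ∣²) (sumBound N) (sumBound-nonneg N)
  (λ k → ∣∣²-nonneg (trigSum π x k)) (trigSum-bounded π x)
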